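{- Let $\mathcal{B}$ be a cartesian bicategory with enough maps. Then $\mathcal{B}$ satisfies the axiom of choice if and only if $\mathcal{B}$ is isomorphic, as a cartesian bicategory, to $\mathrm{Span}^{\sim}(\mathrm{Map}(\mathcal{B}))$ (the latter being defined, i.e. $\mathrm{Map}(\mathcal{B})$ having finite products and weak pullbacks).
   Context: Composition is written in diagrammatic order: for $R\colon X\to Y$, $S\colon Y\to Z$, $R;S\colon X\to Z$. A cartesian bicategory is a (strict) symmetric monoidal category $(\mathcal{B},\otimes,I)$ with symmetry $\sigma$, enriched over posets (each hom-set is partially ordered by $\le$, and $;$ and $\otimes$ are monotone), in which every object $X$ carries morphisms $\delta_X\colon X\to X\otimes X$, $\varepsilon_X\colon X\to I$ such that: (1) $(X,\delta_X,\varepsilon_X)$ is a cocommutative comonoid; (2) $\delta_X,\varepsilon_X$ have right adjoints $\delta_X^*\colon X\otimes X\to X$, $\varepsilon_X^*\colon I\to X$: $\mathrm{id}_X\le\delta_X;\delta_X^*$, $\delta_X^*;\delta_X\le \mathrm{id}_{X\otimes X}$, $\mathrm{id}_X\le \varepsilon_X;\varepsilon_X^*$, $\varepsilon_X^*;\varepsilon_X\le\mathrm{id}_I$; (3) Frobenius law $\delta_X^*;\delta_X=(\mathrm{id}_X\otimes\delta_X);(\delta_X^*\otimes\mathrm{id}_X)$; (4) every $R\colon X\to Y$ satisfies $R;\delta_Y\le\delta_X;(R\otimes R)$ and $R;\varepsilon_Y\le\varepsilon_X$; (5) $\varepsilon_{X\otimes Y}=\varepsilon_X\otimes\varepsilon_Y$,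 $\delta_{X\otimes Y}=(\delta_X\otimes\delta_Y);(\mathrm{id}_X\otimes\sigma_{X,Y}\otimes\mathrm{id}_Y)$, $\varepsilon_I=\mathrm{id}_I$, $\delta_I=\mathrm{id}_I$. A morphism of cartesian bicategories is a monoidal functor preserving the order and the chosen $\delta,\varepsilon,\delta^*,\varepsilon^*$; an isomorphism is such a morphism with an inverse morphism. For $R\colon X\to Y$, its opposite is $R^{op}\colon Y\to X$, $R^{op}=(\mathrm{id}_Y\otimes(\varepsilon_X^*;\delta_X));(\mathrm{id}_Y\otimes R\otimes\mathrm{id}_X);((\delta_Y^*;\varepsilon_Y)\otimes\mathrm{id}_X)$. $R$ is single valued if $\delta_X;(R\otimes R)\le R;\delta_Y$, total if $\varepsilon_X\le R;\varepsilon_Y$. A map is a single valued total morphism; $\mathrm{Map}(\mathcal{B})$ is the category of objects of $\mathcal{B}$ and maps (it is cartesian with product $\otimes$ and terminal object $I$). $\mathcal{B}$ satisfies the axiom of choice if for every total $R\colon X\to Y$ there is a map $f\colon X\to Y$ with $f\le R$. $\mathcal{B}$ has enough maps if for every morphism $R\colon X\to I$ there is a map $f\colon Z\to X$ with $R=f^{op};\varepsilon_Z$. A weak pullback of $h\colon B\to D$, $k\colon C\to D$ is a commutative square $f;h=g;k$ ($f\colon A\to B$, $g\colon A\to C$) such that for all $b\colon T\to B$, $c\colon T\to C$ with $b;h=c;k$ there exists some (not necessarily unique) $t\colon T\to A$ with $t;f=b$, $t;g=c$. For a category $\mathcal{C}$ with finite products and weak pullbacks, $\mathrm{Span}^{\sim}(\mathcal{C})$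 is defined as follows. A span $X\leftarrow A\to Y$ is a pair of arrows of $\mathcal{C}$; set $(X\xleftarrow{} A\to Y)\le(X\leftarrow B\to Y)$ iff there is $\alpha\colon A\to B$ commuting with both legs, and $s_1\sim s_2$ iff $s_1\le s_2\le s_1$. Objects are those of $\mathcal{C}$; morphisms $X\to Y$ are $\sim$-classes of spans, ordered by $\le$; composition of $X\leftarrow A\xrightarrow{f}Y$ and $Y\xleftarrow{g}B\to Z$ is $X\leftarrow P\to Z$ for any weak pullback $P$ of $f,g$; identities are $X\xleftarrow{\mathrm{id}}X\xrightarrow{\mathrm{id}}X$; $\otimes$ is the product of $\mathcal{C}$ (legwise) with unit the terminal object; $\delta_X$ is the class of $X\xleftarrow{\mathrm{id}}X\xrightarrow{\Delta}X\times X$, $\varepsilon_X$ of $X\xleftarrow{\mathrm{id}}X\to 1$, and $\delta_X^*,\varepsilon_X^*$ are the reversed spans. This is a cartesian bicategory. -}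

module Defs where

open import Level using (Level; _⊔_) renaming (suc to lsuc)
open import Relation.Binary.PropositionalEquality using (_≡_; refl; sym; subst; subst₂)
open import Data.Product using (Σ; Σ-syntax; _×_; _,_)

-- Transport of a morphism along an equality of objects (used to express
-- strictness of the monoidal structure: e.g. (X ⊗ Y) ⊗ Z ≡ X ⊗ (Y ⊗ Z)).

castH : ∀ {o h} {Obj : Set o} (Hom : Obj → Obj → Set h)
        (idH : ∀ {X} → Hom X X) {X Y : Obj} → X ≡ Y → Hom X Y
castH Hom idH {X} p = subst (Hom X) p idH

-- Cartesian bicategory: a strict symmetric monoidal category enriched
-- over posets.  Hom-posets are presented as preorders ≤; equality of
-- morphisms is  R ≈ S  :=  R ≤ S × S ≤ R  (the poset quotient).

record CartBicat (o h r : Level) : Set (lsuc (o ⊔ h ⊔ r)) where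
  infixr 9 _⨾_
  infixr 10 _⊗_ _⊗₁_
  infix 4 _≤_ _≈_
  field
    Obj : Set o
    -- objects form a set (as in ordinary category theory)
    Obj-uip : {X Y : Obj} (p q : X ≡ Y) → p ≡ q
    Hom : Obj → Obj → Set h
    _≤_ : ∀ {X Y} → Hom X Y → Hom X Y → Set r
    ≤-refl : ∀ {X Y} {R : Hom X Y} → R ≤ R
    ≤-trans : ∀ {X Y} {R S T : Hom X Y} → R ≤ S → S ≤ T → R ≤ T

    id : ∀ {X} → Hom X X
    _⨾_ : ∀ {X Y Z} → Hom X Y → Hom Y Z → Hom X Z
    ⨾-mono : ∀ {X Y Z} {R R' : Hom X Y} {S S' : Hom Y Z} →
             R ≤ R' → S ≤ S' → R ⨾ S ≤ R' ⨾ S'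

  _≈_ : ∀ {X Y} → Hom X Y → Hom X Y → Set r
  R ≈ S = R ≤ S × S ≤ R

  cast : ∀ {X Y} → X ≡ Y → Hom X Y
  cast = castH Hom id

  field
    ⨾-assoc : ∀ {W X Y Z} (R : Hom W X) (S : Hom X Y) (T : Hom Y Z) →
              (R ⨾ S) ⨾ T ≈ R ⨾ (S ⨾ T)
    ⨾-idˡ : ∀ {X Y} (R : Hom X Y) → id ⨾ R ≈ R
    ⨾-idʳ : ∀ {X Y} (R : Hom X Y) → R ⨾ id ≈ R

    _⊗_ : Obj → Obj → Obj
    I : Obj
    _⊗₁_ : ∀ {X Y X' Y'} → Hom X Y → Hom X' Y' → Hom (X ⊗ X') (Y ⊗ Y')
    ⊗-mono : ∀ {X Y X' Y'} {R S : Hom X Y} {R' S' : Hom X' Y'} →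
             R ≤ S → R' ≤ S' → R ⊗₁ R' ≤ S ⊗₁ S'
    ⊗-id : ∀ {X Y} → id {X} ⊗₁ id {Y} ≈ id
    ⊗-⨾ : ∀ {X Y Z X' Y' Z'} (R : Hom X Y) (S : Hom Y Z)
          (R' : Hom X' Y') (S' : Hom Y' Z') →
          (R ⨾ S) ⊗₁ (R' ⨾ S') ≈ (R ⊗₁ R') ⨾ (S ⊗₁ S')
    assoc₀ : ∀ {X Y Z} → (X ⊗ Y) ⊗ Z ≡ X ⊗ (Y ⊗ Z)
    unitˡ₀ : ∀ {X} → I ⊗ X ≡ X
    unitʳ₀ : ∀ {X} → X ⊗ I ≡ X
    assoc₁ : ∀ {X Y Z X' Y' Z'} (R : Hom X X') (S : Hom Y Y') (T : Hom Z Z') →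
             ((R ⊗₁ S) ⊗₁ T) ⨾ cast assoc₀ ≈ cast assoc₀ ⨾ (R ⊗₁ (S ⊗₁ T))
    unitˡ₁ : ∀ {X Y} (R : Hom X Y) → (id {I} ⊗₁ R) ⨾ cast unitˡ₀ ≈ cast unitˡ₀ ⨾ R
    unitʳ₁ : ∀ {X Y} (R : Hom X Y) → (R ⊗₁ id {I}) ⨾ cast unitʳ₀ ≈ cast unitʳ₀ ⨾ R

    σ : ∀ {X Y} → Hom (X ⊗ Y) (Y ⊗ X)
    σ-nat : ∀ {X Y X' Y'} (R : Hom X Y) (S : Hom X' Y') →
            (R ⊗₁ S) ⨾ σ ≈ σ ⨾ (S ⊗₁ R)
    σ-inv : ∀ {X Y} → σ {X} {Y} ⨾ σ {Y} {X} ≈ id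
    σ-hex : ∀ {X Y Z} →
            σ {X} {Y ⊗ Z} ≈ cast (sym assoc₀) ⨾ (σ {X} {Y} ⊗₁ id {Z}) ⨾ cast assoc₀
                            ⨾ (id {Y} ⊗₁ σ {X} {Z}) ⨾ cast (sym assoc₀)

    δ : ∀ {X} → Hom X (X ⊗ X)
    ε : ∀ {X} → Hom X I
    δ* : ∀ {X} → Hom (X ⊗ X) X
    ε* : ∀ {X} → Hom I X

    δ-coassoc : ∀ {X} → δ {X} ⨾ (δ ⊗₁ id) ⨾ cast assoc₀ ≈ δ ⨾ (id ⊗₁ δ)
    δ-counitˡ : ∀ {X} → δ {X} ⨾ (ε ⊗₁ id) ⨾ cast unitˡ₀ ≈ id
    δ-counitʳ : ∀ {X} → δ {X} ⨾ (id ⊗₁ ε) ⨾ cast unitʳ₀ ≈ id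
    δ-cocomm : ∀ {X} → δ {X} ⨾ σ ≈ δ

    δ-unit : ∀ {X} → id {X} ≤ δ ⨾ δ*
    δ-counit : ∀ {X} → δ* ⨾ δ ≤ id {X ⊗ X}
    ε-unit : ∀ {X} → id {X} ≤ ε ⨾ ε*
    ε-counit : ∀ {X} → ε* {X} ⨾ ε ≤ id {I}

    frobenius : ∀ {X} → δ* {X} ⨾ δ ≈ (id ⊗₁ δ) ⨾ cast (sym assoc₀) ⨾ (δ* ⊗₁ id)

    lax-δ : ∀ {X Y} (R : Hom X Y) → R ⨾ δ ≤ δ ⨾ (R ⊗₁ R)
    lax-ε : ∀ {X Y} (R : Hom X Y) → R ⨾ ε ≤ ε

    ε-⊗ : ∀ {X Y} → ε {X ⊗ Y} ≈ (ε ⊗₁ ε) ⨾ cast unitˡ₀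
    δ-⊗ : ∀ {X Y} →
          δ {X ⊗ Y} ≈ (δ ⊗₁ δ) ⨾ cast assoc₀ ⨾ (id ⊗₁ cast (sym assoc₀))
                      ⨾ (id ⊗₁ (σ {X} {Y} ⊗₁ id)) ⨾ (id ⊗₁ cast assoc₀) ⨾ cast (sym assoc₀)
    ε-I : ε {I} ≈ id
    δ-I : δ {I} ≈ cast (sym unitˡ₀)

module _ {o h r} (B : CartBicat o h r) where
  open CartBicat B

  op : ∀ {X Y} → Hom X Y → Hom Y X
  op {X} {Y} R =
    cast (sym unitʳ₀) ⨾ (id {Y} ⊗₁ (ε* ⨾ δ {X})) ⨾ cast (sym assoc₀)
    ⨾ ((id {Y} ⊗₁ R) ⊗₁ id {X}) ⨾ ((δ* ⨾ ε) ⊗₁ id {X}) ⨾ cast unitˡ₀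

  IsSingleValued : ∀ {X Y} → Hom X Y → Set r
  IsSingleValued R = δ ⨾ (R ⊗₁ R) ≤ R ⨾ δ

  IsTotal : ∀ {X Y} → Hom X Y → Set r
  IsTotal R = ε ≤ R ⨾ ε

  IsMap : ∀ {X Y} → Hom X Y → Set r
  IsMap R = IsSingleValued R × IsTotal R

  AxiomOfChoice : Set (o ⊔ h ⊔ r)
  AxiomOfChoice = ∀ {X Y} (R : Hom X Y) → IsTotal R →
                  Σ[ f ∈ Hom X Y ] (IsMap f × f ≤ R)

  EnoughMaps : Set (o ⊔ h ⊔ r)
  EnoughMaps = ∀ {X} (R : Hom X I) →
               Σ[ Z ∈ Obj ] Σ[ f ∈ Hom Z X ] (IsMap f × R ≈ (op f ⨾ ε {Z}))

  -- Weak pullbacks in Map(B) (morphisms = maps, equality = ≈)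
  record IsWeakPullback {A B' C D : Obj} (hh : Hom B' D) (k : Hom C D)
                        (f : Hom A B') (g : Hom A C) : Set (o ⊔ h ⊔ r) where
    field
      f-map : IsMap f
      g-map : IsMap g
      commutes : f ⨾ hh ≈ g ⨾ k
      universal : ∀ {T} (b : Hom T B') (c : Hom T C) → IsMap b → IsMap c →
                  b ⨾ hh ≈ c ⨾ k →
                  Σ[ t ∈ Hom T A ] (IsMap t × t ⨾ f ≈ b × t ⨾ g ≈ c)

  HasWeakPullbacks : Set (o ⊔ h ⊔ r)
  HasWeakPullbacks = ∀ {B' C D} (hh : Hom B' D) (k : Hom C D) → IsMap hh → IsMap k →
                     Σ[ A ∈ Obj ] Σ[ f ∈ Hom A B' ] Σ[ g ∈ Hom A C ] IsWeakPullback hh k f g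

  -- Span~(Map(B)).  Raw spans (legs are B-morphisms); a morphism of
  -- Span~(Map(B)) is represented by a span whose legs are maps, and
  -- equality of morphisms is the relation ~ (quotient by ~).

  record RawSpan (X Y : Obj) : Set (o ⊔ h) where
    constructor rspan
    field
      apex : Obj
      left : Hom apex X
      right : Hom apex Y

  record Span (X Y : Obj) : Set (o ⊔ h ⊔ r) where
    constructor span
    field
      raw : RawSpan X Y
      left-map : IsMap (RawSpan.left raw)
      right-map : IsMap (RawSpan.right raw)

  open RawSpan
  open Span
  infix 4 _≼_ _~_

  _≼_ : ∀ {X Y} → RawSpan X Y → RawSpan X Y → Set (h ⊔ r)
  s ≼ t = Σ[ α ∈ Hom (apex s) (apex t) ]
            (IsMap α × α ⨾ left t ≈ left s × α ⨾ right t ≈ right s)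

  _~_ : ∀ {X Y} → RawSpan X Y → RawSpan X Y → Set (h ⊔ r)
  s ~ t = s ≼ t × t ≼ s

  reindexS : ∀ {X X' Y Y'} → X ≡ X' → Y ≡ Y' → RawSpan X Y → RawSpan X' Y'
  reindexS p q s = subst₂ RawSpan p q s

  reindexH : ∀ {X X' Y Y'} → X ≡ X' → Y ≡ Y' → Hom X Y → Hom X' Y'
  reindexH p q R = subst₂ Hom p q R

  idS : ∀ {X} → RawSpan X X
  idS {X} = rspan X id id

  compS : HasWeakPullbacks → ∀ {X Y Z} → Span X Y → Span Y Z → RawSpan X Z
  compS wp s t with wp (right (raw s)) (left (raw t)) (right-map s) (left-map t)
  ... | P , p , q , _ = rspan P (p ⨾ left (raw s)) (q ⨾ right (raw t))

  -- ⊗ is the product of Map(B), i.e. ⊗ of B, taken legwise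
  tensorS : ∀ {X Y X' Y'} → RawSpan X Y → RawSpan X' Y' → RawSpan (X ⊗ X') (Y ⊗ Y')
  tensorS s t = rspan (apex s ⊗ apex t) (left s ⊗₁ left t) (right s ⊗₁ right t)

  δS : ∀ {X} → RawSpan X (X ⊗ X)
  δS {X} = rspan X id δ

  εS : ∀ {X} → RawSpan X I
  εS {X} = rspan X id ε

  δ*S : ∀ {X} → RawSpan (X ⊗ X) X
  δ*S {X} = rspan X δ id

  ε*S : ∀ {X} → RawSpan I X
  ε*S {X} = rspan X ε id

  record IsoToSpan (wp : HasWeakPullbacks) : Set (lsuc (o ⊔ h ⊔ r)) where
    field
      F₀ : Obj → Obj
      F₁ : ∀ {X Y} → Hom X Y → Span (F₀ X) (F₀ Y)
      F-mono : ∀ {X Y} {R S : Hom X Y} → R ≤ S → raw (F₁ R) ≼ raw (F₁ S)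
      F-id : ∀ {X} → raw (F₁ (id {X})) ~ idS
      F-⨾ : ∀ {X Y Z} (R : Hom X Y) (S : Hom Y Z) →
            raw (F₁ (R ⨾ S)) ~ compS wp (F₁ R) (F₁ S)
      F-⊗₀ : ∀ {X Y} → F₀ (X ⊗ Y) ≡ F₀ X ⊗ F₀ Y
      F-I₀ : F₀ I ≡ I
      F-⊗₁ : ∀ {X Y X' Y'} (R : Hom X Y) (S : Hom X' Y') →
             reindexS F-⊗₀ F-⊗₀ (raw (F₁ (R ⊗₁ S))) ~ tensorS (raw (F₁ R)) (raw (F₁ S))
      F-δ : ∀ {X} → reindexS refl F-⊗₀ (raw (F₁ (δ {X}))) ~ δS
      F-ε : ∀ {X} → reindexS refl F-I₀ (raw (F₁ (ε {X}))) ~ εS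
      F-δ* : ∀ {X} → reindexS F-⊗₀ refl (raw (F₁ (δ* {X}))) ~ δ*S
      F-ε* : ∀ {X} → reindexS F-I₀ refl (raw (F₁ (ε* {X}))) ~ ε*S

      -- G : Span~(Map(B)) → B  (well defined on ~-classes via G-mono)
      G₀ : Obj → Obj
      G₁ : ∀ {X Y} → Span X Y → Hom (G₀ X) (G₀ Y)
      G-mono : ∀ {X Y} (s t : Span X Y) → raw s ≼ raw t → G₁ s ≤ G₁ t
      G-id : ∀ {X} (u : Span X X) → raw u ~ idS → G₁ u ≈ id
      G-⨾ : ∀ {X Y Z} (s : Span X Y) (t : Span Y Z) (u : Span X Z) →
            raw u ~ compS wp s t → G₁ u ≈ G₁ s ⨾ G₁ t
      G-⊗₀ : ∀ {X Y} → G₀ (X ⊗ Y) ≡ G₀ X ⊗ G₀ Y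
      G-I₀ : G₀ I ≡ I
      G-⊗₁ : ∀ {X Y X' Y'} (s : Span X Y) (t : Span X' Y') (u : Span (X ⊗ X') (Y ⊗ Y')) →
             raw u ~ tensorS (raw s) (raw t) → reindexH G-⊗₀ G-⊗₀ (G₁ u) ≈ G₁ s ⊗₁ G₁ t
      G-δ : ∀ {X} (u : Span X (X ⊗ X)) → raw u ~ δS → reindexH refl G-⊗₀ (G₁ u) ≈ δ
      G-ε : ∀ {X} (u : Span X I) → raw u ~ εS → reindexH refl G-I₀ (G₁ u) ≈ ε
      G-δ* : ∀ {X} (u : Span (X ⊗ X) X) → raw u ~ δ*S → reindexH G-⊗₀ refl (G₁ u) ≈ δ*
      G-ε* : ∀ {X} (u : Span I X) → raw u ~ ε*S → reindexH G-I₀ refl (G₁ u) ≈ ε*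

      GF₀ : ∀ X → G₀ (F₀ X) ≡ X
      FG₀ : ∀ X → F₀ (G₀ X) ≡ X
      GF₁ : ∀ {X Y} (R : Hom X Y) → reindexH (GF₀ X) (GF₀ Y) (G₁ (F₁ R)) ≈ R
      FG₁ : ∀ {X Y} (s : Span X Y) → reindexS (FG₀ X) (FG₀ Y) (raw (F₁ (G₁ s))) ~ raw s

{-# OPTIONS --safe #-}
module Submission where

open import Defs
open import Level using (_⊔_)
open import Data.Product using (Σ; Σ-syntax; _×_; _,_; proj₁; proj₂)
open import Function.Bundles using (_⇔_; mk⇔)
open import Relation.Binary.Bundles using (Poset)
open import Relation.Binary.PropositionalEquality using (_≡_; refl; sym; trans; cong₂)
import Relation.Binary.Reasoning.PartialOrder as PosetReasoning

-- A map f is left adjoint to op f, and conversely left adjoints are maps, so a span of maps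
-- X ←f− A −g→ Y can be sent to op f ⨾ g. With enough maps every R : X → Y is of this form: bend R
-- to a morphism X ⊗ Y → I, write that as op h ⨾ ε, and take the two components of h. Under choice
-- the order op f ⨾ g ≤ op f' ⨾ g' yields a morphism of spans: the relation between the apexes
-- "equal images under both legs" is total, and a map contained in it commutes with the legs.
-- Weak pullbacks of h, k are then the spans representing h ⨾ op k.
--
-- Conversely, given an isomorphism F, G, totality of R splits the left leg of F R by a map a. The
-- graph of a followed by the right leg of F R is a left adjoint below F R, and G carries it to a
-- left adjoint, that is a map, below R.

module CartBicatProperties {o h r} (B : CartBicat o h r) where
  open CartBicat B

  private variable
    W X Y Z X' Y' : Obj

  -- Hom-posets and rewriting inside composites

  homPoset : Obj → Obj → Poset h r r
  homPoset X Y = record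
    { Carrier = Hom X Y
    ; _≈_ = _≈_
    ; _≤_ = _≤_
    ; isPartialOrder = record
      { isPreorder = record
        { isEquivalence = record
          { refl = ≤-refl , ≤-refl
          ; sym = λ (p , q) → q , p
          ; trans = λ (p , q) (p' , q') → ≤-trans p p' , ≤-trans q' q
          }
        ; reflexive = proj₁
        ; trans = ≤-trans
        }
      ; antisym = _,_
      }
    }

  open module HomPoset {X Y} = Poset (homPoset X Y) using (module Eq)
  open module HomReasoning {X Y} = PosetReasoning (homPoset X Y)

  ≈-refl : {R : Hom X Y} → R ≈ R
  ≈-refl = Eq.refl

  ≈-sym : {R S : Hom X Y} → R ≈ S → S ≈ R
  ≈-sym = Eq.sym

  ≈-trans : {R S T : Hom X Y} → R ≈ S → S ≈ T → R ≈ T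
  ≈-trans = Eq.trans

  ⨾-monoˡ : {R R' : Hom X Y} {S : Hom Y Z} → R ≤ R' → R ⨾ S ≤ R' ⨾ S
  ⨾-monoˡ p = ⨾-mono p ≤-refl

  ⨾-monoʳ : {R : Hom X Y} {S S' : Hom Y Z} → S ≤ S' → R ⨾ S ≤ R ⨾ S'
  ⨾-monoʳ = ⨾-mono ≤-refl

  ⨾-cong : {R R' : Hom X Y} {S S' : Hom Y Z} → R ≈ R' → S ≈ S' → R ⨾ S ≈ R' ⨾ S'
  ⨾-cong (p , p') (q , q') = ⨾-mono p q , ⨾-mono p' q'

  ⨾-congˡ : {R R' : Hom X Y} {S : Hom Y Z} → R ≈ R' → R ⨾ S ≈ R' ⨾ S
  ⨾-congˡ p = ⨾-cong p ≈-refl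

  ⨾-congʳ : {R : Hom X Y} {S S' : Hom Y Z} → S ≈ S' → R ⨾ S ≈ R ⨾ S'
  ⨾-congʳ = ⨾-cong ≈-refl

  ⊗-cong : {R S : Hom X Y} {R' S' : Hom X' Y'} → R ≈ S → R' ≈ S' → R ⊗₁ R' ≈ S ⊗₁ S'
  ⊗-cong (p , p') (q , q') = ⊗-mono p q , ⊗-mono p' q'

  pullˡ : {R : Hom W X} {S : Hom X Y} {T : Hom W Y} {U : Hom Y Z} →
          R ⨾ S ≈ T → R ⨾ S ⨾ U ≈ T ⨾ U
  pullˡ p = ≈-trans (≈-sym (⨾-assoc _ _ _)) (⨾-congˡ p)

  pushˡ : {R : Hom W X} {S : Hom X Y} {T : Hom W Y} {U : Hom Y Z} →
          T ≈ R ⨾ S → T ⨾ U ≈ R ⨾ S ⨾ U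
  pushˡ p = ≈-sym (pullˡ (≈-sym p))

  extendˡ : {R : Hom W X} {S : Hom X Y} {R' : Hom W X'} {S' : Hom X' Y} {U : Hom Y Z} →
            R ⨾ S ≈ R' ⨾ S' → R ⨾ S ⨾ U ≈ R' ⨾ S' ⨾ U
  extendˡ p = ≈-trans (pullˡ p) (⨾-assoc _ _ _)

  elimˡ : {R : Hom X X} {S : Hom X Y} → R ≈ id → R ⨾ S ≈ S
  elimˡ p = ≈-trans (⨾-congˡ p) (⨾-idˡ _)

  cancelˡ : {R : Hom X Y} {S : Hom Y X} {T : Hom X Z} → R ⨾ S ≈ id → R ⨾ S ⨾ T ≈ T
  cancelˡ p = ≈-trans (pullˡ p) (⨾-idˡ _)

  extend≤ : {R : Hom W X} {S : Hom X Y} {R' : Hom W X'} {S' : Hom X' Y} {U : Hom Y Z} →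
            R ⨾ S ≤ R' ⨾ S' → R ⨾ S ⨾ U ≤ R' ⨾ S' ⨾ U
  extend≤ {R = R} {S} {R'} {S'} {U} p = begin
    R ⨾ S ⨾ U      ≈⟨ ⨾-assoc _ _ _ ⟨
    (R ⨾ S) ⨾ U    ≤⟨ ⨾-monoˡ p ⟩
    (R' ⨾ S') ⨾ U  ≈⟨ ⨾-assoc _ _ _ ⟩
    R' ⨾ S' ⨾ U    ∎

  introˡ≤ : {R : Hom X Y} {S : Hom Y X} {T : Hom X Z} → id ≤ R ⨾ S → T ≤ R ⨾ S ⨾ T
  introˡ≤ {R = R} {S} {T} p = begin
    T            ≈⟨ ⨾-idˡ T ⟨
    id ⨾ T       ≤⟨ ⨾-monoˡ p ⟩
    (R ⨾ S) ⨾ T  ≈⟨ ⨾-assoc _ _ _ ⟩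
    R ⨾ S ⨾ T    ∎

  cancelˡ≤ : {R : Hom X Y} {S : Hom Y X} {T : Hom X Z} → R ⨾ S ≤ id → R ⨾ S ⨾ T ≤ T
  cancelˡ≤ {R = R} {S} {T} p = begin
    R ⨾ S ⨾ T    ≈⟨ ⨾-assoc _ _ _ ⟨
    (R ⨾ S) ⨾ T  ≤⟨ ⨾-monoˡ p ⟩
    id ⨾ T       ≈⟨ ⨾-idˡ T ⟩
    T            ∎

  ⊗-⨾ˡ : {R : Hom X Y} {S : Hom Y Z} → (R ⨾ S) ⊗₁ id {W} ≈ R ⊗₁ id ⨾ S ⊗₁ id
  ⊗-⨾ˡ = ≈-trans (⊗-cong ≈-refl (≈-sym (⨾-idˡ id))) (⊗-⨾ _ _ _ _)

  ⊗-⨾ʳ : {R : Hom X Y} {S : Hom Y Z} → id {W} ⊗₁ (R ⨾ S) ≈ id ⊗₁ R ⨾ id ⊗₁ S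
  ⊗-⨾ʳ = ≈-trans (⊗-cong (≈-sym (⨾-idˡ id)) ≈-refl) (⊗-⨾ _ _ _ _)

  ⊗-splitˡ : {R : Hom X Y} {S : Hom X' Y'} → R ⊗₁ S ≈ R ⊗₁ id ⨾ id ⊗₁ S
  ⊗-splitˡ = ≈-trans (⊗-cong (≈-sym (⨾-idʳ _)) (≈-sym (⨾-idˡ _))) (⊗-⨾ _ _ _ _)

  ⊗-splitʳ : {R : Hom X Y} {S : Hom X' Y'} → R ⊗₁ S ≈ id ⊗₁ S ⨾ R ⊗₁ id
  ⊗-splitʳ = ≈-trans (⊗-cong (≈-sym (⨾-idˡ _)) (≈-sym (⨾-idʳ _))) (⊗-⨾ _ _ _ _)

  -- Structural isomorphisms and coherence

  α : Hom ((X ⊗ Y) ⊗ Z) (X ⊗ (Y ⊗ Z))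
  α = cast assoc₀

  α⁻¹ : Hom (X ⊗ (Y ⊗ Z)) ((X ⊗ Y) ⊗ Z)
  α⁻¹ = cast (sym assoc₀)

  ƛ : Hom (I ⊗ X) X
  ƛ = cast unitˡ₀

  ƛ⁻¹ : Hom X (I ⊗ X)
  ƛ⁻¹ = cast (sym unitˡ₀)

  ρ : Hom (X ⊗ I) X
  ρ = cast unitʳ₀

  ρ⁻¹ : Hom X (X ⊗ I)
  ρ⁻¹ = cast (sym unitʳ₀)

  cast-invʳ : (p : X ≡ Y) → cast p ⨾ cast (sym p) ≈ id
  cast-invʳ refl = ⨾-idˡ id

  cast-invˡ : (p : X ≡ Y) → cast (sym p) ⨾ cast p ≈ id
  cast-invˡ refl = ⨾-idˡ id

  cast-flip : (p : X ≡ X') (q : Y ≡ Y') {R : Hom X Y} {R' : Hom X' Y'} →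
              R ⨾ cast q ≈ cast p ⨾ R' → cast (sym p) ⨾ R ≈ R' ⨾ cast (sym q)
  cast-flip refl refl e =
    ≈-trans (⨾-idˡ _) (≈-trans (≈-sym (⨾-idʳ _)) (≈-trans e (≈-trans (⨾-idˡ _) (≈-sym (⨾-idʳ _)))))

  α⁻¹-nat : (R : Hom X X') (S : Hom Y Y') (T : Hom Z W) →
            α⁻¹ ⨾ (R ⊗₁ S) ⊗₁ T ≈ R ⊗₁ (S ⊗₁ T) ⨾ α⁻¹
  α⁻¹-nat R S T = cast-flip assoc₀ assoc₀ (assoc₁ R S T)

  ρ⁻¹-nat : (R : Hom X Y) → ρ⁻¹ ⨾ R ⊗₁ id ≈ R ⨾ ρ⁻¹
  ρ⁻¹-nat R = cast-flip unitʳ₀ unitʳ₀ (unitʳ₁ R)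

  -- Marks the structural morphisms. The class is closed under `⨾` and `⊗₁`, so a coherence goal is
  -- settled by listing the factors of its two sides.
  IsCast : Hom X Y → Set (o ⊔ r)
  IsCast {X} {Y} R = Σ[ p ∈ X ≡ Y ] R ≈ cast p

  cast-isCast : (p : X ≡ Y) → IsCast (cast p)
  cast-isCast p = p , ≈-refl

  id-isCast : IsCast (id {X})
  id-isCast = cast-isCast refl

  cast-⨾ : (p : X ≡ Y) (q : Y ≡ Z) → cast p ⨾ cast q ≈ cast (trans p q)
  cast-⨾ refl q = ⨾-idˡ _

  cast-⊗ : (p : X ≡ Y) (q : X' ≡ Y') → cast p ⊗₁ cast q ≈ cast (cong₂ _⊗_ p q)
  cast-⊗ refl refl = ⊗-id

  infixr 9 _⨾ᶜ_
  infixr 10 _⊗ᶜ_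

  _⨾ᶜ_ : {R : Hom X Y} {S : Hom Y Z} → IsCast R → IsCast S → IsCast (R ⨾ S)
  (p , e) ⨾ᶜ (q , e') = trans p q , ≈-trans (⨾-cong e e') (cast-⨾ p q)

  _⊗ᶜ_ : {R : Hom X Y} {S : Hom X' Y'} → IsCast R → IsCast S → IsCast (R ⊗₁ S)
  (p , e) ⊗ᶜ (q , e') = cong₂ _⊗_ p q , ≈-trans (⊗-cong e e') (cast-⊗ p q)

  -- Objects form a set, so the two underlying equalities coincide. This one fact covers the
  -- pentagon, the triangle and all other re-bracketings.
  coherence : {R S : Hom X Y} → IsCast R → IsCast S → R ≈ S
  coherence (p , e) (q , e') rewrite Obj-uip p q = ≈-trans e (≈-sym e')

  αᶜ : IsCast (α {X} {Y} {Z})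
  αᶜ = cast-isCast _

  α⁻¹ᶜ : IsCast (α⁻¹ {X} {Y} {Z})
  α⁻¹ᶜ = cast-isCast _

  ƛᶜ : IsCast (ƛ {X})
  ƛᶜ = cast-isCast _

  ƛ⁻¹ᶜ : IsCast (ƛ⁻¹ {X})
  ƛ⁻¹ᶜ = cast-isCast _

  ρᶜ : IsCast (ρ {X})
  ρᶜ = cast-isCast _

  ρ⁻¹ᶜ : IsCast (ρ⁻¹ {X})
  ρ⁻¹ᶜ = cast-isCast _

  -- Adjunctions in the hom-posets

  infix 4 _⊣_

  _⊣_ : Hom X Y → Hom Y X → Set r
  F ⊣ G = id ≤ F ⨾ G × G ⨾ F ≤ id

  ⊣-antitone : {F F' : Hom X Y} {G G' : Hom Y X} → F ⊣ G → F' ⊣ G' → F' ≤ F → G ≤ G'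
  ⊣-antitone {F = F} {F'} {G} {G'} (_ , ε₁) (η₂ , _) F'≤F = begin
    G            ≈⟨ ⨾-idʳ G ⟨
    G ⨾ id       ≤⟨ ⨾-monoʳ η₂ ⟩
    G ⨾ F' ⨾ G'  ≤⟨ ⨾-monoʳ (⨾-monoˡ F'≤F) ⟩
    G ⨾ F ⨾ G'   ≤⟨ cancelˡ≤ ε₁ ⟩
    G'           ∎

  -- Transfers an equation between left adjoints to their mates; with `⊣-⨾` and `⊣-⊗`, laws of `δ`
  -- and `ε` become laws of `δ*` and `ε*`.
  ⊣-unique : {F F' : Hom X Y} {G G' : Hom Y X} → F ⊣ G → F' ⊣ G' → F ≈ F' → G ≈ G'
  ⊣-unique a a' (p , q) = ⊣-antitone a a' q , ⊣-antitone a' a p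

  ⊣-id : id {X} ⊣ id
  ⊣-id = proj₂ (⨾-idˡ id) , proj₁ (⨾-idˡ id)

  ⊣-⨾ : {F : Hom X Y} {G : Hom Y X} {F' : Hom Y Z} {G' : Hom Z Y} →
        F ⊣ G → F' ⊣ G' → F ⨾ F' ⊣ G' ⨾ G
  ⊣-⨾ {F = F} {G} {F'} {G'} (η₁ , ε₁) (η₂ , ε₂) = unit , counit
    where
      unit : id ≤ (F ⨾ F') ⨾ G' ⨾ G
      unit = begin
        id                   ≤⟨ η₁ ⟩
        F ⨾ G                ≤⟨ ⨾-monoʳ (introˡ≤ η₂) ⟩
        F ⨾ F' ⨾ G' ⨾ G      ≈⟨ ⨾-assoc _ _ _ ⟨
        (F ⨾ F') ⨾ G' ⨾ G    ∎
      counit : (G' ⨾ G) ⨾ F ⨾ F' ≤ id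
      counit = begin
        (G' ⨾ G) ⨾ F ⨾ F'  ≈⟨ ⨾-assoc _ _ _ ⟩
        G' ⨾ G ⨾ F ⨾ F'    ≤⟨ ⨾-monoʳ (cancelˡ≤ ε₁) ⟩
        G' ⨾ F'            ≤⟨ ε₂ ⟩
        id                 ∎

  ⊣-⊗ : {F : Hom X Y} {G : Hom Y X} {F' : Hom X' Y'} {G' : Hom Y' X'} →
        F ⊣ G → F' ⊣ G' → F ⊗₁ F' ⊣ G ⊗₁ G'
  ⊣-⊗ {F = F} {G} {F'} {G'} (η₁ , ε₁) (η₂ , ε₂) = unit , counit
    where
      unit : id ≤ F ⊗₁ F' ⨾ G ⊗₁ G'
      unit = begin
        id                    ≈⟨ ⊗-id ⟨
        id ⊗₁ id              ≤⟨ ⊗-mono η₁ η₂ ⟩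
        (F ⨾ G) ⊗₁ (F' ⨾ G')  ≈⟨ ⊗-⨾ _ _ _ _ ⟩
        F ⊗₁ F' ⨾ G ⊗₁ G'     ∎
      counit : G ⊗₁ G' ⨾ F ⊗₁ F' ≤ id
      counit = begin
        G ⊗₁ G' ⨾ F ⊗₁ F'     ≈⟨ ⊗-⨾ _ _ _ _ ⟨
        (G ⨾ F) ⊗₁ (G' ⨾ F')  ≤⟨ ⊗-mono ε₁ ε₂ ⟩
        id ⊗₁ id              ≈⟨ ⊗-id ⟩
        id                    ∎

  -- The comonoid and its right adjoint monoid

  δ⊣δ* : δ {X} ⊣ δ*
  δ⊣δ* = δ-unit , δ-counit

  ε⊣ε* : ε {X} ⊣ ε*
  ε⊣ε* = ε-unit , ε-counit

  σ⊣σ : σ {X} {Y} ⊣ σ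
  σ⊣σ = proj₂ σ-inv , proj₁ σ-inv

  cast-⊣ : (p : X ≡ Y) → cast p ⊣ cast (sym p)
  cast-⊣ p = proj₂ (cast-invʳ p) , proj₁ (cast-invˡ p)

  -- The laws of the monoid δ*, ε* are the mates of those of the comonoid δ, ε.
  δ*-comm : σ ⨾ δ* {X} ≈ δ*
  δ*-comm = ⊣-unique (⊣-⨾ δ⊣δ* σ⊣σ) δ⊣δ* δ-cocomm

  δ*-unitˡ : (ƛ⁻¹ ⨾ ε* ⊗₁ id) ⨾ δ* {X} ≈ id
  δ*-unitˡ = ⊣-unique (⊣-⨾ δ⊣δ* (⊣-⨾ (⊣-⊗ ε⊣ε* ⊣-id) (cast-⊣ unitˡ₀))) ⊣-id δ-counitˡ

  δ*-unitʳ : (ρ⁻¹ ⨾ id ⊗₁ ε*) ⨾ δ* {X} ≈ id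
  δ*-unitʳ = ⊣-unique (⊣-⨾ δ⊣δ* (⊣-⨾ (⊣-⊗ ⊣-id ε⊣ε*) (cast-⊣ unitʳ₀))) ⊣-id δ-counitʳ

  -- The mate of `lax-δ`: the unit creates a `δ` after `R`, which moves to the front of `R` and is
  -- cancelled there by the counit.
  lax-δ* : (R : Hom X Y) → δ* ⨾ R ≤ R ⊗₁ R ⨾ δ*
  lax-δ* R = begin
    δ* ⨾ R                ≈⟨ ⨾-congʳ (⨾-idʳ R) ⟨
    δ* ⨾ R ⨾ id           ≤⟨ ⨾-monoʳ (⨾-monoʳ δ-unit) ⟩
    δ* ⨾ R ⨾ δ ⨾ δ*       ≤⟨ ⨾-monoʳ (extend≤ (lax-δ R)) ⟩
    δ* ⨾ δ ⨾ R ⊗₁ R ⨾ δ*  ≤⟨ cancelˡ≤ δ-counit ⟩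
    R ⊗₁ R ⨾ δ*           ∎

  lax-ε* : (R : Hom X Y) → ε* ⨾ R ≤ ε*
  lax-ε* R = begin
    ε* ⨾ R             ≈⟨ ⨾-congʳ (⨾-idʳ R) ⟨
    ε* ⨾ R ⨾ id        ≤⟨ ⨾-monoʳ (⨾-monoʳ ε-unit) ⟩
    ε* ⨾ R ⨾ ε ⨾ ε*    ≈⟨ ⨾-congʳ (⨾-assoc _ _ _) ⟨
    ε* ⨾ (R ⨾ ε) ⨾ ε*  ≤⟨ ⨾-monoʳ (⨾-monoˡ (lax-ε R)) ⟩
    ε* ⨾ ε ⨾ ε*        ≤⟨ cancelˡ≤ ε-counit ⟩
    ε*                 ∎

  -- The right adjoint `G` satisfies `lax-δ` and `lax-ε` like every morphism; moving `G` across the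
  -- adjunction reverses these into single-valuedness and totality of `F`.
  leftAdjoint-isMap : {F : Hom X Y} {G : Hom Y X} → F ⊣ G → IsMap B F
  leftAdjoint-isMap {F = F} {G} (η , ϵ) = single , total
    where
      single : δ ⨾ F ⊗₁ F ≤ F ⨾ δ
      single = begin
        δ ⨾ F ⊗₁ F                ≤⟨ introˡ≤ η ⟩
        F ⨾ G ⨾ δ ⨾ F ⊗₁ F        ≤⟨ ⨾-monoʳ (extend≤ (lax-δ G)) ⟩
        F ⨾ δ ⨾ G ⊗₁ G ⨾ F ⊗₁ F   ≤⟨ ⨾-monoʳ (⨾-monoʳ (proj₂ (⊣-⊗ (η , ϵ) (η , ϵ)))) ⟩
        F ⨾ δ ⨾ id                ≈⟨ ⨾-congʳ (⨾-idʳ δ) ⟩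
        F ⨾ δ                     ∎
      total : ε ≤ F ⨾ ε
      total = begin
        ε          ≤⟨ introˡ≤ η ⟩
        F ⨾ G ⨾ ε  ≤⟨ ⨾-monoʳ (lax-ε G) ⟩
        F ⨾ ε      ∎

  -- Self-duality: cups, caps and bending

  cup : Hom I (X ⊗ X)
  cup = ε* ⨾ δ

  cap : Hom (X ⊗ X) I
  cap = δ* ⨾ ε

  cap-comm : σ ⨾ cap {X} ≈ cap
  cap-comm = pullˡ δ*-comm

  -- The transpose of `T` under the self-duality: the second input wire is turned into an output by
  -- `cup`.
  unbend : Hom (X ⊗ Y) I → Hom X Y
  unbend T = ρ⁻¹ ⨾ id ⊗₁ cup ⨾ α⁻¹ ⨾ T ⊗₁ id ⨾ ƛ

  unbend-mono : {T U : Hom (X ⊗ Y) I} → T ≤ U → unbend T ≤ unbend U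
  unbend-mono p = ⨾-monoʳ (⨾-monoʳ (⨾-monoʳ (⨾-monoˡ (⊗-mono p ≤-refl))))

  unbend-op : {R : Hom X Y} → op B R ≈ unbend (id ⊗₁ R ⨾ cap)
  unbend-op = ⨾-congʳ (⨾-congʳ (⨾-congʳ (pullˡ (≈-sym ⊗-⨾ˡ))))

  op-mono : {R S : Hom X Y} → R ≤ S → op B R ≤ op B S
  op-mono {R = R} {S} p = begin
    op B R                     ≈⟨ unbend-op ⟩
    unbend (id ⊗₁ R ⨾ cap)  ≤⟨ unbend-mono (⨾-monoˡ (⊗-mono ≤-refl p)) ⟩
    unbend (id ⊗₁ S ⨾ cap)  ≈⟨ unbend-op ⟨
    op B S                     ∎

  -- The Frobenius law fuses the zigzag of `δ` and `δ*` into `δ* ⨾ δ`, after which `ε*` and `ε`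
  -- disappear by the unit and counit laws.
  snake : unbend (cap {X}) ≈ id
  snake = begin-equality
    ρ⁻¹ ⨾ id ⊗₁ (ε* ⨾ δ) ⨾ α⁻¹ ⨾ (δ* ⨾ ε) ⊗₁ id ⨾ ƛ
      ≈⟨ ⨾-congʳ (pushˡ ⊗-⨾ʳ) ⟩
    ρ⁻¹ ⨾ id ⊗₁ ε* ⨾ id ⊗₁ δ ⨾ α⁻¹ ⨾ (δ* ⨾ ε) ⊗₁ id ⨾ ƛ
      ≈⟨ ⨾-congʳ (⨾-congʳ (⨾-congʳ (⨾-congʳ (pushˡ ⊗-⨾ˡ)))) ⟩
    ρ⁻¹ ⨾ id ⊗₁ ε* ⨾ id ⊗₁ δ ⨾ α⁻¹ ⨾ δ* ⊗₁ id ⨾ ε ⊗₁ id ⨾ ƛ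
      ≈⟨ ⨾-congʳ (⨾-congʳ (⨾-congʳ (⨾-assoc _ _ _))) ⟨
    ρ⁻¹ ⨾ id ⊗₁ ε* ⨾ id ⊗₁ δ ⨾ (α⁻¹ ⨾ δ* ⊗₁ id) ⨾ ε ⊗₁ id ⨾ ƛ
      ≈⟨ ⨾-congʳ (⨾-congʳ (extendˡ frobenius)) ⟨
    ρ⁻¹ ⨾ id ⊗₁ ε* ⨾ δ* ⨾ δ ⨾ ε ⊗₁ id ⨾ ƛ
      ≈⟨ ⨾-congʳ (⨾-congʳ (⨾-congʳ δ-counitˡ)) ⟩
    ρ⁻¹ ⨾ id ⊗₁ ε* ⨾ δ* ⨾ id
      ≈⟨ ⨾-congʳ (⨾-congʳ (⨾-idʳ δ*)) ⟩
    ρ⁻¹ ⨾ id ⊗₁ ε* ⨾ δ*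
      ≈⟨ ⨾-assoc _ _ _ ⟨
    (ρ⁻¹ ⨾ id ⊗₁ ε*) ⨾ δ*
      ≈⟨ δ*-unitʳ ⟩
    id ∎

  unbend-⨾ : (R : Hom X Y) (T : Hom (Y ⊗ Z) I) → unbend (R ⊗₁ id ⨾ T) ≈ R ⨾ unbend T
  unbend-⨾ R T = begin-equality
    ρ⁻¹ ⨾ id ⊗₁ cup ⨾ α⁻¹ ⨾ (R ⊗₁ id ⨾ T) ⊗₁ id ⨾ ƛ
      ≈⟨ ⨾-congʳ (⨾-congʳ (⨾-congʳ (pushˡ ⊗-⨾ˡ))) ⟩
    ρ⁻¹ ⨾ id ⊗₁ cup ⨾ α⁻¹ ⨾ (R ⊗₁ id) ⊗₁ id ⨾ T ⊗₁ id ⨾ ƛ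
      ≈⟨ ⨾-congʳ (⨾-congʳ (extendˡ (α⁻¹-nat R id id))) ⟩
    ρ⁻¹ ⨾ id ⊗₁ cup ⨾ R ⊗₁ (id ⊗₁ id) ⨾ α⁻¹ ⨾ T ⊗₁ id ⨾ ƛ
      ≈⟨ ⨾-congʳ (⨾-congʳ (⨾-congˡ (⊗-cong ≈-refl ⊗-id))) ⟩
    ρ⁻¹ ⨾ id ⊗₁ cup ⨾ R ⊗₁ id ⨾ α⁻¹ ⨾ T ⊗₁ id ⨾ ƛ
      ≈⟨ ⨾-congʳ (extendˡ (≈-trans (≈-sym ⊗-splitʳ) ⊗-splitˡ)) ⟩
    ρ⁻¹ ⨾ R ⊗₁ id ⨾ id ⊗₁ cup ⨾ α⁻¹ ⨾ T ⊗₁ id ⨾ ƛ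
      ≈⟨ extendˡ (ρ⁻¹-nat R) ⟩
    R ⨾ ρ⁻¹ ⨾ id ⊗₁ cup ⨾ α⁻¹ ⨾ T ⊗₁ id ⨾ ƛ ∎

  -- `unbend` is monotone, and by `snake` it undoes bending, so inequalities may be tested on bent
  -- morphisms.
  bend-reflects-≤ : {R S : Hom X Y} → R ⊗₁ id ⨾ cap ≤ S ⊗₁ id ⨾ cap → R ≤ S
  bend-reflects-≤ {R = R} {S} p = begin
    R                          ≈⟨ unbend-bend R ⟨
    unbend (R ⊗₁ id ⨾ cap)     ≤⟨ unbend-mono p ⟩
    unbend (S ⊗₁ id ⨾ cap)     ≈⟨ unbend-bend S ⟩
    S                          ∎
    where
      unbend-bend : (R : Hom X Y) → unbend (R ⊗₁ id ⨾ cap) ≈ R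
      unbend-bend R = ≈-trans (unbend-⨾ R cap) (≈-trans (⨾-congʳ snake) (⨾-idʳ R))

  -- The mate of coassociativity; only the opposite inequality needs the Frobenius law.
  lax-frobenius : δ* ⨾ δ {X} ≤ δ ⊗₁ id ⨾ α ⨾ id ⊗₁ δ*
  lax-frobenius = begin
    δ* ⨾ δ                                ≈⟨ ⨾-congʳ (⨾-idʳ δ) ⟨
    δ* ⨾ δ ⨾ id                           ≤⟨ ⨾-monoʳ (⨾-monoʳ (proj₁ (⊣-⊗ ⊣-id δ⊣δ*))) ⟩
    δ* ⨾ δ ⨾ id ⊗₁ δ ⨾ id ⊗₁ δ*           ≈⟨ ⨾-congʳ (extendˡ δ-coassoc) ⟨
    δ* ⨾ δ ⨾ (δ ⊗₁ id ⨾ α) ⨾ id ⊗₁ δ*     ≤⟨ cancelˡ≤ δ-counit ⟩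
    (δ ⊗₁ id ⨾ α) ⨾ id ⊗₁ δ*              ≈⟨ ⨾-assoc _ _ _ ⟩
    δ ⊗₁ id ⨾ α ⨾ id ⊗₁ δ*                ∎

  -- The mirror image of `snake`, with `lax-frobenius` in the role of the Frobenius law, hence an
  -- inequality.
  lax-snake : id {X} ≤ ƛ⁻¹ ⨾ cup ⊗₁ id ⨾ α ⨾ id ⊗₁ cap ⨾ ρ
  lax-snake = begin
    id
      ≈⟨ ⨾-idˡ id ⟨
    id ⨾ id
      ≈⟨ ⨾-cong (≈-trans (≈-sym (⨾-assoc _ _ _)) δ*-unitˡ) δ-counitʳ ⟨
    (ƛ⁻¹ ⨾ ε* ⊗₁ id ⨾ δ*) ⨾ δ ⨾ id ⊗₁ ε ⨾ ρ
      ≈⟨ ≈-trans (⨾-assoc _ _ _) (⨾-congʳ (⨾-assoc _ _ _)) ⟩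
    ƛ⁻¹ ⨾ ε* ⊗₁ id ⨾ δ* ⨾ δ ⨾ id ⊗₁ ε ⨾ ρ
      ≤⟨ ⨾-monoʳ (⨾-monoʳ (extend≤ lax-frobenius)) ⟩
    ƛ⁻¹ ⨾ ε* ⊗₁ id ⨾ δ ⊗₁ id ⨾ (α ⨾ id ⊗₁ δ*) ⨾ id ⊗₁ ε ⨾ ρ
      ≈⟨ ⨾-congʳ (pullˡ (≈-sym ⊗-⨾ˡ)) ⟩
    ƛ⁻¹ ⨾ cup ⊗₁ id ⨾ (α ⨾ id ⊗₁ δ*) ⨾ id ⊗₁ ε ⨾ ρ
      ≈⟨ ⨾-congʳ (⨾-congʳ (⨾-assoc _ _ _)) ⟩
    ƛ⁻¹ ⨾ cup ⊗₁ id ⨾ α ⨾ id ⊗₁ δ* ⨾ id ⊗₁ ε ⨾ ρ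
      ≈⟨ ⨾-congʳ (⨾-congʳ (⨾-congʳ (pullˡ (≈-sym ⊗-⨾ʳ)))) ⟩
    ƛ⁻¹ ⨾ cup ⊗₁ id ⨾ α ⨾ id ⊗₁ cap ⨾ ρ ∎

  -- A zigzag from `lax-snake` is inserted on the second wire of `T`. Once `T` slides past the final
  -- `cap`, the `cup` together with `T` forms `unbend T`, and the `cap` is what remains.
  bend-unbend : (T : Hom (Y ⊗ X) I) → T ≤ unbend T ⊗₁ id ⨾ cap
  bend-unbend T = begin
    T
      ≈⟨ elimˡ ⊗-id ⟨
    id ⊗₁ id ⨾ T
      ≤⟨ ⨾-monoˡ (⊗-mono ≤-refl lax-snake) ⟩
    id ⊗₁ (ƛ⁻¹ ⨾ cup ⊗₁ id ⨾ α ⨾ id ⊗₁ cap ⨾ ρ) ⨾ T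
      ≈⟨ pushˡ ⊗-⨾ʳ ⟩
    id ⊗₁ ƛ⁻¹ ⨾ id ⊗₁ (cup ⊗₁ id ⨾ α ⨾ id ⊗₁ cap ⨾ ρ) ⨾ T
      ≈⟨ ⨾-congʳ (pushˡ ⊗-⨾ʳ) ⟩
    id ⊗₁ ƛ⁻¹ ⨾ id ⊗₁ (cup ⊗₁ id) ⨾ id ⊗₁ (α ⨾ id ⊗₁ cap ⨾ ρ) ⨾ T
      ≈⟨ ⨾-congʳ (⨾-congʳ (pushˡ ⊗-⨾ʳ)) ⟩
    id ⊗₁ ƛ⁻¹ ⨾ id ⊗₁ (cup ⊗₁ id) ⨾ id ⊗₁ α ⨾ id ⊗₁ (id ⊗₁ cap ⨾ ρ) ⨾ T
      ≈⟨ ⨾-congʳ (⨾-congʳ (⨾-congʳ right)) ⟩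
    id ⊗₁ ƛ⁻¹ ⨾ id ⊗₁ (cup ⊗₁ id) ⨾ id ⊗₁ α ⨾ α⁻¹ ⨾ T ⊗₁ id ⨾ ƛ ⨾ cap
      -- The triangle identity.
      ≈⟨ ⨾-congˡ (coherence (id-isCast ⊗ᶜ ƛ⁻¹ᶜ) ((ρ⁻¹ᶜ ⊗ᶜ id-isCast) ⨾ᶜ αᶜ)) ⟩
    (ρ⁻¹ ⊗₁ id ⨾ α) ⨾ id ⊗₁ (cup ⊗₁ id) ⨾ id ⊗₁ α ⨾ α⁻¹ ⨾ T ⊗₁ id ⨾ ƛ ⨾ cap
      ≈⟨ ⨾-assoc _ _ _ ⟩
    ρ⁻¹ ⊗₁ id ⨾ α ⨾ id ⊗₁ (cup ⊗₁ id) ⨾ id ⊗₁ α ⨾ α⁻¹ ⨾ T ⊗₁ id ⨾ ƛ ⨾ cap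
      ≈⟨ ⨾-congʳ (extendˡ (assoc₁ id cup id)) ⟨
    ρ⁻¹ ⊗₁ id ⨾ (id ⊗₁ cup) ⊗₁ id ⨾ α ⨾ id ⊗₁ α ⨾ α⁻¹ ⨾ T ⊗₁ id ⨾ ƛ ⨾ cap
      -- The pentagon, with some associators inverted.
      ≈⟨ ⨾-congʳ (⨾-congʳ (≈-trans (≈-sym (≈-trans (⨾-assoc _ _ _) (⨾-congʳ (⨾-assoc _ _ _)))) (pushˡ (coherence ((αᶜ ⨾ᶜ id-isCast ⊗ᶜ αᶜ ⨾ᶜ α⁻¹ᶜ)) ((α⁻¹ᶜ ⊗ᶜ id-isCast) ⨾ᶜ αᶜ))))) ⟩
    ρ⁻¹ ⊗₁ id ⨾ (id ⊗₁ cup) ⊗₁ id ⨾ α⁻¹ ⊗₁ id ⨾ α ⨾ T ⊗₁ id ⨾ ƛ ⨾ cap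
      ≈⟨ ⨾-congʳ (⨾-congʳ (⨾-congʳ (⨾-congʳ (⨾-congˡ (⊗-cong ≈-refl ⊗-id))))) ⟨
    ρ⁻¹ ⊗₁ id ⨾ (id ⊗₁ cup) ⊗₁ id ⨾ α⁻¹ ⊗₁ id ⨾ α ⨾ T ⊗₁ (id ⊗₁ id) ⨾ ƛ ⨾ cap
      ≈⟨ ⨾-congʳ (⨾-congʳ (⨾-congʳ (extendˡ (assoc₁ T id id)))) ⟨
    ρ⁻¹ ⊗₁ id ⨾ (id ⊗₁ cup) ⊗₁ id ⨾ α⁻¹ ⊗₁ id ⨾ (T ⊗₁ id) ⊗₁ id ⨾ α ⨾ ƛ ⨾ cap
      ≈⟨ ⨾-congʳ (⨾-congʳ (⨾-congʳ (⨾-congʳ (pullˡ (coherence (αᶜ ⨾ᶜ ƛᶜ) (ƛᶜ ⊗ᶜ id-isCast)))))) ⟩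
    ρ⁻¹ ⊗₁ id ⨾ (id ⊗₁ cup) ⊗₁ id ⨾ α⁻¹ ⊗₁ id ⨾ (T ⊗₁ id) ⊗₁ id ⨾ ƛ ⊗₁ id ⨾ cap
      ≈⟨ ⨾-congʳ (⨾-congʳ (⨾-congʳ (pullˡ (≈-sym ⊗-⨾ˡ)))) ⟩
    ρ⁻¹ ⊗₁ id ⨾ (id ⊗₁ cup) ⊗₁ id ⨾ α⁻¹ ⊗₁ id ⨾ (T ⊗₁ id ⨾ ƛ) ⊗₁ id ⨾ cap
      ≈⟨ ⨾-congʳ (⨾-congʳ (pullˡ (≈-sym ⊗-⨾ˡ))) ⟩
    ρ⁻¹ ⊗₁ id ⨾ (id ⊗₁ cup) ⊗₁ id ⨾ (α⁻¹ ⨾ T ⊗₁ id ⨾ ƛ) ⊗₁ id ⨾ cap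
      ≈⟨ ⨾-congʳ (pullˡ (≈-sym ⊗-⨾ˡ)) ⟩
    ρ⁻¹ ⊗₁ id ⨾ (id ⊗₁ cup ⨾ α⁻¹ ⨾ T ⊗₁ id ⨾ ƛ) ⊗₁ id ⨾ cap
      ≈⟨ pullˡ (≈-sym ⊗-⨾ˡ) ⟩
    unbend T ⊗₁ id ⨾ cap ∎
    where
      right : id ⊗₁ (id ⊗₁ cap ⨾ ρ) ⨾ T ≈ α⁻¹ ⨾ T ⊗₁ id ⨾ ƛ ⨾ cap
      right = begin-equality
        id ⊗₁ (id ⊗₁ cap ⨾ ρ) ⨾ T
          ≈⟨ pushˡ ⊗-⨾ʳ ⟩
        id ⊗₁ (id ⊗₁ cap) ⨾ id ⊗₁ ρ ⨾ T
          ≈⟨ ⨾-congʳ (pushˡ (coherence (id-isCast ⊗ᶜ ρᶜ) (α⁻¹ᶜ ⨾ᶜ ρᶜ))) ⟩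
        id ⊗₁ (id ⊗₁ cap) ⨾ α⁻¹ ⨾ ρ ⨾ T
          ≈⟨ extendˡ (α⁻¹-nat id id cap) ⟨
        α⁻¹ ⨾ (id ⊗₁ id) ⊗₁ cap ⨾ ρ ⨾ T
          ≈⟨ ⨾-congʳ (⨾-cong (⊗-cong ⊗-id ≈-refl) (≈-sym (unitʳ₁ T))) ⟩
        α⁻¹ ⨾ id ⊗₁ cap ⨾ T ⊗₁ id ⨾ ρ
          ≈⟨ ⨾-congʳ (extendˡ (≈-trans (≈-sym ⊗-splitʳ) ⊗-splitˡ)) ⟩
        α⁻¹ ⨾ T ⊗₁ id ⨾ id ⊗₁ cap ⨾ ρ
          -- Both unitors are taken at `I ⊗ I`, where they agree.
          ≈⟨ ⨾-congʳ (⨾-congʳ (⨾-congʳ (coherence ρᶜ ƛᶜ))) ⟩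
        α⁻¹ ⨾ T ⊗₁ id ⨾ id ⊗₁ cap ⨾ ƛ
          ≈⟨ ⨾-congʳ (⨾-congʳ (unitˡ₁ cap)) ⟩
        α⁻¹ ⨾ T ⊗₁ id ⨾ ƛ ⨾ cap ∎

  -- Maps as left adjoints

  -- Totality lets `F ⊗₁ F` be inserted before `cap`, which gives the unit; single-valuedness lets
  -- `cup` absorb `F ⊗₁ F`, which gives the counit. In both cases `snake` accounts for the bare
  -- zigzag.
  map-⊣-op : {F : Hom X Y} → IsMap B F → F ⊣ op B F
  map-⊣-op {F = F} (single , total) = unit , counit
    where
      unit : id ≤ F ⨾ op B F
      unit = begin
        id                                ≈⟨ snake ⟨
        unbend cap                        ≤⟨ unbend-mono (⨾-monoʳ total) ⟩
        unbend (δ* ⨾ F ⨾ ε)               ≤⟨ unbend-mono (extend≤ (lax-δ* F)) ⟩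
        unbend (F ⊗₁ F ⨾ cap)             ≤⟨ unbend-mono (proj₁ (pushˡ ⊗-splitˡ)) ⟩
        unbend (F ⊗₁ id ⨾ id ⊗₁ F ⨾ cap)  ≈⟨ unbend-⨾ F _ ⟩
        F ⨾ unbend (id ⊗₁ F ⨾ cap)        ≈⟨ ⨾-congʳ unbend-op ⟨
        F ⨾ op B F                        ∎
      cup-single : cup ⨾ F ⊗₁ F ≤ cup
      cup-single = begin
        (ε* ⨾ δ) ⨾ F ⊗₁ F  ≈⟨ ⨾-assoc _ _ _ ⟩
        ε* ⨾ δ ⨾ F ⊗₁ F    ≤⟨ ⨾-monoʳ single ⟩
        ε* ⨾ F ⨾ δ         ≈⟨ ⨾-assoc _ _ _ ⟨
        (ε* ⨾ F) ⨾ δ       ≤⟨ ⨾-monoˡ (lax-ε* F) ⟩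
        ε* ⨾ δ             ∎
      counit : op B F ⨾ F ≤ id
      counit = begin
        op B F ⨾ F
          ≈⟨ ≈-trans (⨾-assoc _ _ _) (⨾-congʳ (≈-trans (⨾-assoc _ _ _) (⨾-congʳ (≈-trans (⨾-assoc _ _ _) (⨾-congʳ (≈-trans (⨾-assoc _ _ _) (⨾-congʳ (⨾-assoc _ _ _)))))))) ⟩
        ρ⁻¹ ⨾ id ⊗₁ cup ⨾ α⁻¹ ⨾ (id ⊗₁ F) ⊗₁ id ⨾ cap ⊗₁ id ⨾ ƛ ⨾ F
          ≈⟨ ⨾-congʳ (⨾-congʳ (⨾-congʳ (⨾-congʳ (⨾-congʳ (unitˡ₁ F))))) ⟨
        ρ⁻¹ ⨾ id ⊗₁ cup ⨾ α⁻¹ ⨾ (id ⊗₁ F) ⊗₁ id ⨾ cap ⊗₁ id ⨾ id ⊗₁ F ⨾ ƛ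
          ≈⟨ ⨾-congʳ (⨾-congʳ (⨾-congʳ (⨾-congʳ (extendˡ (≈-trans (≈-sym ⊗-splitˡ) ⊗-splitʳ))))) ⟩
        ρ⁻¹ ⨾ id ⊗₁ cup ⨾ α⁻¹ ⨾ (id ⊗₁ F) ⊗₁ id ⨾ id ⊗₁ F ⨾ cap ⊗₁ id ⨾ ƛ
          ≈⟨ ⨾-congʳ (⨾-congʳ (⨾-congʳ (pullˡ (≈-sym ⊗-splitˡ)))) ⟩
        ρ⁻¹ ⨾ id ⊗₁ cup ⨾ α⁻¹ ⨾ (id ⊗₁ F) ⊗₁ F ⨾ cap ⊗₁ id ⨾ ƛ
          ≈⟨ ⨾-congʳ (⨾-congʳ (extendˡ (α⁻¹-nat id F F))) ⟩
        ρ⁻¹ ⨾ id ⊗₁ cup ⨾ id ⊗₁ (F ⊗₁ F) ⨾ α⁻¹ ⨾ cap ⊗₁ id ⨾ ƛ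
          ≈⟨ ⨾-congʳ (pullˡ (≈-sym ⊗-⨾ʳ)) ⟩
        ρ⁻¹ ⨾ id ⊗₁ (cup ⨾ F ⊗₁ F) ⨾ α⁻¹ ⨾ cap ⊗₁ id ⨾ ƛ
          ≤⟨ ⨾-monoʳ (⨾-monoˡ (⊗-mono ≤-refl cup-single)) ⟩
        unbend cap
          ≈⟨ snake ⟩
        id ∎

  id-isMap : IsMap B (id {X})
  id-isMap = leftAdjoint-isMap ⊣-id

  δ-isMap : IsMap B (δ {X})
  δ-isMap = leftAdjoint-isMap δ⊣δ*

  ε-isMap : IsMap B (ε {X})
  ε-isMap = leftAdjoint-isMap ε⊣ε*

  ⨾-isMap : {F : Hom X Y} {G : Hom Y Z} → IsMap B F → IsMap B G → IsMap B (F ⨾ G)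
  ⨾-isMap m n = leftAdjoint-isMap (⊣-⨾ (map-⊣-op m) (map-⊣-op n))

  ⊗-isMap : {F : Hom X Y} {G : Hom X' Y'} → IsMap B F → IsMap B G → IsMap B (F ⊗₁ G)
  ⊗-isMap m n = leftAdjoint-isMap (⊣-⊗ (map-⊣-op m) (map-⊣-op n))

  op-unique : {F : Hom X Y} {G : Hom Y X} → F ⊣ G → op B F ≈ G
  op-unique a = ⊣-unique (map-⊣-op (leftAdjoint-isMap a)) a ≈-refl

  op-⨾ : {F : Hom X Y} {G : Hom Y Z} → IsMap B F → IsMap B G → op B (F ⨾ G) ≈ op B G ⨾ op B F
  op-⨾ m n = op-unique (⊣-⨾ (map-⊣-op m) (map-⊣-op n))

  op-⊗ : {F : Hom X Y} {G : Hom X' Y'} → IsMap B F → IsMap B G →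
         op B (F ⊗₁ G) ≈ op B F ⊗₁ op B G
  op-⊗ m n = op-unique (⊣-⊗ (map-⊣-op m) (map-⊣-op n))

  -- `op` preserves the order while passing to right adjoints reverses it, so the order on maps is
  -- discrete. Equations between maps can therefore be proved as single inequalities.
  map-≤⇒≈ : {F G : Hom X Y} → IsMap B F → IsMap B G → F ≤ G → F ≈ G
  map-≤⇒≈ {F = F} {G} m n F≤G = F≤G , (begin
    G               ≤⟨ introˡ≤ (proj₁ (map-⊣-op m)) ⟩
    F ⨾ op B F ⨾ G  ≤⟨ ⨾-monoʳ (⨾-monoˡ (op-mono F≤G)) ⟩
    F ⨾ op B G ⨾ G  ≤⟨ ⨾-monoʳ (proj₂ (map-⊣-op n)) ⟩
    F ⨾ id          ≈⟨ ⨾-idʳ F ⟩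
    F               ∎)

  -- `below` pushes `F` through `δ*` and cancels `op B F ⨾ F`. `above` turns the cap over by
  -- symmetry and applies `bend-unbend` to `id ⊗₁ F ⨾ cap`, whose transpose is `op B F`.
  cap-slide : {F : Hom X Y} → IsMap B F → id ⊗₁ op B F ⨾ cap ≈ F ⊗₁ id ⨾ cap
  cap-slide {F = F} m@(_ , total) = below , above
    where
      below : id ⊗₁ op B F ⨾ cap ≤ F ⊗₁ id ⨾ cap
      below = begin
        id ⊗₁ op B F ⨾ δ* ⨾ ε            ≤⟨ ⨾-monoʳ (⨾-monoʳ total) ⟩
        id ⊗₁ op B F ⨾ δ* ⨾ F ⨾ ε        ≤⟨ ⨾-monoʳ (extend≤ (lax-δ* F)) ⟩
        id ⊗₁ op B F ⨾ F ⊗₁ F ⨾ δ* ⨾ ε   ≈⟨ pullˡ (≈-sym (⊗-⨾ _ _ _ _)) ⟩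
        (id ⨾ F) ⊗₁ (op B F ⨾ F) ⨾ cap   ≤⟨ ⨾-monoˡ (⊗-mono (proj₁ (⨾-idˡ F)) (proj₂ (map-⊣-op m))) ⟩
        F ⊗₁ id ⨾ cap                    ∎
      above : F ⊗₁ id ⨾ cap ≤ id ⊗₁ op B F ⨾ cap
      above = begin
        F ⊗₁ id ⨾ cap           ≈⟨ ⨾-congʳ cap-comm ⟨
        F ⊗₁ id ⨾ σ ⨾ cap       ≈⟨ extendˡ (σ-nat F id) ⟩
        σ ⨾ id ⊗₁ F ⨾ cap       ≤⟨ ⨾-monoʳ (bend-unbend _) ⟩
        σ ⨾ unbend (id ⊗₁ F ⨾ cap) ⊗₁ id ⨾ cap
                                ≈⟨ ⨾-congʳ (⨾-congˡ (⊗-cong unbend-op ≈-refl)) ⟨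
        σ ⨾ op B F ⊗₁ id ⨾ cap  ≈⟨ extendˡ (σ-nat id (op B F)) ⟨
        id ⊗₁ op B F ⨾ σ ⨾ cap  ≈⟨ ⨾-congʳ cap-comm ⟩
        id ⊗₁ op B F ⨾ cap      ∎

  -- Pairing and projections of maps

  ⟨_,_⟩ : Hom Z X → Hom Z Y → Hom Z (X ⊗ Y)
  ⟨ F , G ⟩ = δ ⨾ F ⊗₁ G

  π₁ : Hom (X ⊗ Y) X
  π₁ = id ⊗₁ ε ⨾ ρ

  π₂ : Hom (X ⊗ Y) Y
  π₂ = ε ⊗₁ id ⨾ ƛ

  π₁-isMap : IsMap B (π₁ {X} {Y})
  π₁-isMap = leftAdjoint-isMap (⊣-⨾ (⊣-⊗ ⊣-id ε⊣ε*) (cast-⊣ unitʳ₀))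

  π₂-isMap : IsMap B (π₂ {X} {Y})
  π₂-isMap = leftAdjoint-isMap (⊣-⨾ (⊣-⊗ ε⊣ε* ⊣-id) (cast-⊣ unitˡ₀))

  pair-⊣ : {F : Hom Z X} {G : Hom Z Y} → IsMap B F → IsMap B G →
           ⟨ F , G ⟩ ⊣ op B F ⊗₁ op B G ⨾ δ*
  pair-⊣ m n = ⊣-⨾ δ⊣δ* (⊣-⊗ (map-⊣-op m) (map-⊣-op n))

  pair-isMap : {F : Hom Z X} {G : Hom Z Y} → IsMap B F → IsMap B G → IsMap B ⟨ F , G ⟩
  pair-isMap m n = leftAdjoint-isMap (pair-⊣ m n)

  total-ε : {F : Hom X Y} → IsMap B F → F ⨾ ε ≈ ε
  total-ε (_ , total) = lax-ε _ , total

  pair-π₁ : {F : Hom Z X} {G : Hom Z Y} → IsMap B G → ⟨ F , G ⟩ ⨾ π₁ ≈ F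
  pair-π₁ {F = F} {G} n = begin-equality
    (δ ⨾ F ⊗₁ G) ⨾ id ⊗₁ ε ⨾ ρ     ≈⟨ ⨾-assoc _ _ _ ⟩
    δ ⨾ F ⊗₁ G ⨾ id ⊗₁ ε ⨾ ρ       ≈⟨ ⨾-congʳ (pullˡ (≈-sym (⊗-⨾ _ _ _ _))) ⟩
    δ ⨾ (F ⨾ id) ⊗₁ (G ⨾ ε) ⨾ ρ    ≈⟨ ⨾-congʳ (⨾-congˡ (⊗-cong (⨾-idʳ F) (total-ε n))) ⟩
    δ ⨾ F ⊗₁ ε ⨾ ρ                 ≈⟨ ⨾-congʳ (pushˡ ⊗-splitʳ) ⟩
    δ ⨾ id ⊗₁ ε ⨾ F ⊗₁ id ⨾ ρ      ≈⟨ ⨾-congʳ (⨾-congʳ (unitʳ₁ F)) ⟩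
    δ ⨾ id ⊗₁ ε ⨾ ρ ⨾ F            ≈⟨ ⨾-congʳ (⨾-assoc _ _ _) ⟨
    δ ⨾ (id ⊗₁ ε ⨾ ρ) ⨾ F          ≈⟨ cancelˡ δ-counitʳ ⟩
    F                              ∎

  pair-π₂ : {F : Hom Z X} {G : Hom Z Y} → IsMap B F → ⟨ F , G ⟩ ⨾ π₂ ≈ G
  pair-π₂ {F = F} {G} m = begin-equality
    (δ ⨾ F ⊗₁ G) ⨾ ε ⊗₁ id ⨾ ƛ     ≈⟨ ⨾-assoc _ _ _ ⟩
    δ ⨾ F ⊗₁ G ⨾ ε ⊗₁ id ⨾ ƛ       ≈⟨ ⨾-congʳ (pullˡ (≈-sym (⊗-⨾ _ _ _ _))) ⟩
    δ ⨾ (F ⨾ ε) ⊗₁ (G ⨾ id) ⨾ ƛ    ≈⟨ ⨾-congʳ (⨾-congˡ (⊗-cong (total-ε m) (⨾-idʳ G))) ⟩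
    δ ⨾ ε ⊗₁ G ⨾ ƛ                 ≈⟨ ⨾-congʳ (pushˡ ⊗-splitˡ) ⟩
    δ ⨾ ε ⊗₁ id ⨾ id ⊗₁ G ⨾ ƛ      ≈⟨ ⨾-congʳ (⨾-congʳ (unitˡ₁ G)) ⟩
    δ ⨾ ε ⊗₁ id ⨾ ƛ ⨾ G            ≈⟨ ⨾-congʳ (⨾-assoc _ _ _) ⟨
    δ ⨾ (ε ⊗₁ id ⨾ ƛ) ⨾ G          ≈⟨ cancelˡ δ-counitˡ ⟩
    G                              ∎

  -- Up to a unitor `ε ⊗₁ ε` is the `ε` of the tensor product, and `lax-ε` lets this absorb any
  -- morphism before it.
  σ-discard : σ {X} {Y} ⨾ ε ⊗₁ ε ≤ ε ⊗₁ ε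
  σ-discard = begin
    σ ⨾ ε ⊗₁ ε      ≈⟨ ⨾-congʳ discard ⟩
    σ ⨾ ε ⨾ ƛ⁻¹     ≈⟨ ⨾-assoc _ _ _ ⟨
    (σ ⨾ ε) ⨾ ƛ⁻¹   ≤⟨ ⨾-monoˡ (lax-ε σ) ⟩
    ε ⨾ ƛ⁻¹         ≈⟨ discard ⟨
    ε ⊗₁ ε          ∎
    where
      discard : ε {X} ⊗₁ ε {Y} ≈ ε ⨾ ƛ⁻¹
      discard = begin-equality
        ε ⊗₁ ε                ≈⟨ ⨾-idʳ _ ⟨
        ε ⊗₁ ε ⨾ id           ≈⟨ ⨾-congʳ (cast-invʳ unitˡ₀) ⟨
        ε ⊗₁ ε ⨾ ƛ ⨾ ƛ⁻¹      ≈⟨ pushˡ ε-⊗ ⟨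
        ε ⨾ ƛ⁻¹               ∎

  -- Only ≤ is needed because maps are discretely ordered, so the coherence σ ≈ id on I ⊗ I is
  -- replaced by lax-ε.
  pair-projections : δ {X ⊗ Y} ⨾ π₁ ⊗₁ π₂ ≤ id
  pair-projections = begin
    δ ⨾ π₁ ⊗₁ π₂
      ≈⟨ ⨾-cong δ-⊗ (⊗-⨾ _ _ _ _) ⟩
    (δ ⊗₁ δ ⨾ α ⨾ id ⊗₁ α⁻¹ ⨾ id ⊗₁ (σ ⊗₁ id) ⨾ id ⊗₁ α ⨾ α⁻¹) ⨾ (id ⊗₁ ε) ⊗₁ (ε ⊗₁ id) ⨾ ρ ⊗₁ ƛ
      ≈⟨ ≈-trans (⨾-assoc _ _ _) (⨾-congʳ (≈-trans (⨾-assoc _ _ _) (⨾-congʳ (≈-trans (⨾-assoc _ _ _) (⨾-congʳ (≈-trans (⨾-assoc _ _ _) (⨾-congʳ (⨾-assoc _ _ _)))))))) ⟩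
    δ ⊗₁ δ ⨾ α ⨾ id ⊗₁ α⁻¹ ⨾ id ⊗₁ (σ ⊗₁ id) ⨾ id ⊗₁ α ⨾ α⁻¹ ⨾ (id ⊗₁ ε) ⊗₁ (ε ⊗₁ id) ⨾ ρ ⊗₁ ƛ
      ≈⟨ ⨾-congʳ (⨾-congʳ (⨾-congʳ (⨾-congʳ (⨾-congʳ (extendˡ (α⁻¹-nat id ε _)))))) ⟩
    δ ⊗₁ δ ⨾ α ⨾ id ⊗₁ α⁻¹ ⨾ id ⊗₁ (σ ⊗₁ id) ⨾ id ⊗₁ α ⨾ id ⊗₁ (ε ⊗₁ (ε ⊗₁ id)) ⨾ α⁻¹ ⨾ ρ ⊗₁ ƛ
      ≈⟨ ⨾-congʳ (⨾-congʳ (⨾-congʳ (⨾-congʳ (extendˡ (⊗-⨾-congʳ (≈-sym (assoc₁ ε ε id))))))) ⟩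
    δ ⊗₁ δ ⨾ α ⨾ id ⊗₁ α⁻¹ ⨾ id ⊗₁ (σ ⊗₁ id) ⨾ id ⊗₁ ((ε ⊗₁ ε) ⊗₁ id) ⨾ id ⊗₁ α ⨾ α⁻¹ ⨾ ρ ⊗₁ ƛ
      ≈⟨ ⨾-congʳ (⨾-congʳ (⨾-congʳ (pullˡ (≈-trans (≈-sym ⊗-⨾ʳ) (⊗-cong ≈-refl (≈-sym ⊗-⨾ˡ)))))) ⟩
    δ ⊗₁ δ ⨾ α ⨾ id ⊗₁ α⁻¹ ⨾ id ⊗₁ ((σ ⨾ ε ⊗₁ ε) ⊗₁ id) ⨾ id ⊗₁ α ⨾ α⁻¹ ⨾ ρ ⊗₁ ƛ
      ≤⟨ ⨾-monoʳ (⨾-monoʳ (⨾-monoʳ (⨾-monoˡ (⊗-mono ≤-refl (⊗-mono σ-discard ≤-refl))))) ⟩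
    δ ⊗₁ δ ⨾ α ⨾ id ⊗₁ α⁻¹ ⨾ id ⊗₁ ((ε ⊗₁ ε) ⊗₁ id) ⨾ id ⊗₁ α ⨾ α⁻¹ ⨾ ρ ⊗₁ ƛ
      ≈⟨ ⨾-congʳ (⨾-congʳ (extendˡ (⊗-⨾-congʳ (α⁻¹-nat ε ε id)))) ⟩
    δ ⊗₁ δ ⨾ α ⨾ id ⊗₁ (ε ⊗₁ (ε ⊗₁ id)) ⨾ id ⊗₁ α⁻¹ ⨾ id ⊗₁ α ⨾ α⁻¹ ⨾ ρ ⊗₁ ƛ
      ≈⟨ ⨾-congʳ (extendˡ (assoc₁ id ε (ε ⊗₁ id))) ⟨
    δ ⊗₁ δ ⨾ (id ⊗₁ ε) ⊗₁ (ε ⊗₁ id) ⨾ α ⨾ id ⊗₁ α⁻¹ ⨾ id ⊗₁ α ⨾ α⁻¹ ⨾ ρ ⊗₁ ƛ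
      ≈⟨ pullˡ (≈-sym (⊗-⨾ _ _ _ _)) ⟩
    (δ ⨾ id ⊗₁ ε) ⊗₁ (δ ⨾ ε ⊗₁ id) ⨾ α ⨾ id ⊗₁ α⁻¹ ⨾ id ⊗₁ α ⨾ α⁻¹ ⨾ ρ ⊗₁ ƛ
      ≈⟨ ⨾-congˡ (⊗-cong (split unitʳ₀ δ-counitʳ) (split unitˡ₀ δ-counitˡ)) ⟩
    ρ⁻¹ ⊗₁ ƛ⁻¹ ⨾ α ⨾ id ⊗₁ α⁻¹ ⨾ id ⊗₁ α ⨾ α⁻¹ ⨾ ρ ⊗₁ ƛ
      ≈⟨ coherence (ρ⁻¹ᶜ ⊗ᶜ ƛ⁻¹ᶜ ⨾ᶜ αᶜ ⨾ᶜ id-isCast ⊗ᶜ α⁻¹ᶜ ⨾ᶜ id-isCast ⊗ᶜ αᶜ ⨾ᶜ α⁻¹ᶜ ⨾ᶜ ρᶜ ⊗ᶜ ƛᶜ) id-isCast ⟩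
    id ∎
    where
      ⊗-⨾-congʳ : {R : Hom X Y} {S : Hom Y Z} {R' : Hom X X'} {S' : Hom X' Z} → R ⨾ S ≈ R' ⨾ S' →
                  id {W} ⊗₁ R ⨾ id ⊗₁ S ≈ id ⊗₁ R' ⨾ id ⊗₁ S'
      ⊗-⨾-congʳ p = ≈-trans (≈-sym ⊗-⨾ʳ) (≈-trans (⊗-cong ≈-refl p) ⊗-⨾ʳ)
      split : (p : X ≡ Y) {R : Hom Y Z} {S : Hom Z X} → R ⨾ S ⨾ cast p ≈ id → R ⨾ S ≈ cast (sym p)
      split refl e = ≈-trans (⨾-congʳ (≈-sym (⨾-idʳ _))) e

  -- Single-valuedness moves the `δ` from before `H` to after it, where `pair-projections` applies;
  -- the resulting inequality is between maps.
  pair-η : {H : Hom Z (X ⊗ Y)} → IsMap B H → ⟨ H ⨾ π₁ , H ⨾ π₂ ⟩ ≈ H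
  pair-η {H = H} m@(single , _) =
    map-≤⇒≈ (pair-isMap (⨾-isMap m π₁-isMap) (⨾-isMap m π₂-isMap)) m (begin
      δ ⨾ (H ⨾ π₁) ⊗₁ (H ⨾ π₂)  ≈⟨ ⨾-congʳ (⊗-⨾ _ _ _ _) ⟩
      δ ⨾ H ⊗₁ H ⨾ π₁ ⊗₁ π₂     ≤⟨ extend≤ single ⟩
      H ⨾ δ ⨾ π₁ ⊗₁ π₂          ≤⟨ ⨾-monoʳ pair-projections ⟩
      H ⨾ id                    ≈⟨ ⨾-idʳ H ⟩
      H                         ∎)

  -- Links a span from `X` to `Y` with a single map into `X ⊗ Y`: apart from its final `ε`, the
  -- right-hand side is the right adjoint of `⟨ F , G ⟩` found in `pair-⊣`.
  bend-span : {F : Hom Z X} {G : Hom Z Y} → IsMap B G →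
              (op B F ⨾ G) ⊗₁ id ⨾ cap ≈ op B F ⊗₁ op B G ⨾ cap
  bend-span {F = F} {G} n = begin-equality
    (op B F ⨾ G) ⊗₁ id ⨾ cap          ≈⟨ pushˡ ⊗-⨾ˡ ⟩
    op B F ⊗₁ id ⨾ G ⊗₁ id ⨾ cap      ≈⟨ ⨾-congʳ (cap-slide n) ⟨
    op B F ⊗₁ id ⨾ id ⊗₁ op B G ⨾ cap ≈⟨ pullˡ (≈-sym ⊗-splitˡ) ⟩
    op B F ⊗₁ op B G ⨾ cap            ∎

  -- Spans of maps and the morphisms they represent

  open RawSpan
  open Span

  toHom : RawSpan B X Y → Hom X Y
  toHom s = op B (left s) ⨾ right s

  record Tabulation (R : Hom X Y) : Set (o ⊔ h ⊔ r) where
    field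
      tab : Span B X Y
      toHom-tab : toHom (raw tab) ≈ R

  -- The left triangle `a ⨾ f' ≈ f` transposes to `op B f ⨾ a ≤ op B f'`; the right triangle makes
  -- `a` appear after `op B f`.
  ≼⇒≤ : (s t : Span B X Y) → _≼_ B (raw s) (raw t) → toHom (raw s) ≤ toHom (raw t)
  ≼⇒≤ (span (rspan _ f g) fm _) (span (rspan _ f' g') fm' _) (a , am , af' , ag') = begin
    op B f ⨾ g        ≈⟨ ⨾-congʳ ag' ⟨
    op B f ⨾ a ⨾ g'   ≈⟨ ⨾-assoc _ _ _ ⟨
    (op B f ⨾ a) ⨾ g' ≤⟨ ⨾-monoˡ legs ⟩
    op B f' ⨾ g'      ∎
    where
      legs : op B f ⨾ a ≤ op B f'
      legs = begin
        op B f ⨾ a                   ≈⟨ ⨾-congʳ (⨾-idʳ a) ⟨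
        op B f ⨾ a ⨾ id              ≤⟨ ⨾-monoʳ (⨾-monoʳ (proj₁ (map-⊣-op fm'))) ⟩
        op B f ⨾ a ⨾ f' ⨾ op B f'    ≈⟨ ⨾-congʳ (pullˡ af') ⟩
        op B f ⨾ f ⨾ op B f'         ≤⟨ cancelˡ≤ (proj₂ (map-⊣-op fm)) ⟩
        op B f'                      ∎

  ~⇒≈ : (s t : Span B X Y) → _~_ B (raw s) (raw t) → toHom (raw s) ≈ toHom (raw t)
  ~⇒≈ s t (p , q) = ≼⇒≤ s t p , ≼⇒≤ t s q

  -- Spans representing a morphism, from enough maps

  module _ (enough : EnoughMaps B) where

    tabulate : (R : Hom X Y) → Tabulation R
    tabulate R with enough (R ⊗₁ id ⨾ cap)
    ... | Z , H , m , e = record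
      { tab = span (rspan Z F G) F-isMap G-isMap
      ; toHom-tab = bend-reflects-≤ (proj₁ eq) , bend-reflects-≤ (proj₂ eq)
      }
      where
        F = H ⨾ π₁
        G = H ⨾ π₂
        F-isMap = ⨾-isMap m π₁-isMap
        G-isMap = ⨾-isMap m π₂-isMap
        eq : (op B F ⨾ G) ⊗₁ id ⨾ cap ≈ R ⊗₁ id ⨾ cap
        eq = begin-equality
          (op B F ⨾ G) ⊗₁ id ⨾ cap        ≈⟨ bend-span G-isMap ⟩
          op B F ⊗₁ op B G ⨾ δ* ⨾ ε       ≈⟨ ⨾-assoc _ _ _ ⟨
          (op B F ⊗₁ op B G ⨾ δ*) ⨾ ε     ≈⟨ ⨾-congˡ (⊣-unique (pair-⊣ F-isMap G-isMap) (map-⊣-op m) (pair-η m)) ⟩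
          op B H ⨾ ε                      ≈⟨ e ⟨
          R ⊗₁ id ⨾ cap                   ∎

  -- The order on spans under choice

  module _ (choice : AxiomOfChoice B) where

    -- Choice supplies a map `a` with `a ⨾ ⟨ f' , g' ⟩ ≤ ⟨ f , g ⟩`. Projecting gives an inequality
    -- for each leg, and between maps these are equalities.
    ≤⇒≼ : (s t : Span B X Y) → toHom (raw s) ≤ toHom (raw t) → _≼_ B (raw s) (raw t)
    ≤⇒≼ (span (rspan _ f g) fm gm) (span (rspan _ f' g') fm' gm') p =
      a , am ,
      map-≤⇒≈ (⨾-isMap am fm') fm (begin
        a ⨾ f'                  ≈⟨ ⨾-congʳ (pair-π₁ gm') ⟨
        a ⨾ ⟨ f' , g' ⟩ ⨾ π₁    ≤⟨ extend ⟩
        ⟨ f , g ⟩ ⨾ π₁          ≈⟨ pair-π₁ gm ⟩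
        f                       ∎) ,
      map-≤⇒≈ (⨾-isMap am gm') gm (begin
        a ⨾ g'                  ≈⟨ ⨾-congʳ (pair-π₂ fm') ⟨
        a ⨾ ⟨ f' , g' ⟩ ⨾ π₂    ≤⟨ extend ⟩
        ⟨ f , g ⟩ ⨾ π₂          ≈⟨ pair-π₂ fm ⟩
        g                       ∎)
      where
        -- T relates the elements of the two apexes with equal images under both legs.
        T = ⟨ f , g ⟩ ⨾ op B f' ⊗₁ op B g' ⨾ δ*
        -- The value of `g` is duplicated and compared with itself by `δ ⨾ cap`. Inserting
        -- `f ⨾ op B f` before one copy exposes `op B f ⨾ g`, to which `p` applies, and `bend-span`
        -- reassembles `T`.
        T-total : IsTotal B T
        T-total = begin
          ε                                             ≤⟨ proj₂ gm ⟩
          g ⨾ ε                                         ≤⟨ ⨾-monoʳ (introˡ≤ δ-unit) ⟩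
          g ⨾ δ ⨾ cap                                   ≤⟨ extend≤ (lax-δ g) ⟩
          δ ⨾ g ⊗₁ g ⨾ cap                              ≤⟨ ⨾-monoʳ (⨾-monoˡ (⊗-mono (introˡ≤ (proj₁ (map-⊣-op fm))) ≤-refl)) ⟩
          δ ⨾ (f ⨾ op B f ⨾ g) ⊗₁ g ⨾ cap               ≤⟨ ⨾-monoʳ (⨾-monoˡ (⊗-mono (⨾-monoʳ p) ≤-refl)) ⟩
          δ ⨾ (f ⨾ op B f' ⨾ g') ⊗₁ g ⨾ cap             ≈⟨ ⨾-congʳ (⨾-congˡ (⊗-cong ≈-refl (⨾-idʳ g))) ⟨
          δ ⨾ (f ⨾ op B f' ⨾ g') ⊗₁ (g ⨾ id) ⨾ cap      ≈⟨ ⨾-congʳ (pushˡ (⊗-⨾ _ _ _ _)) ⟩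
          δ ⨾ f ⊗₁ g ⨾ (op B f' ⨾ g') ⊗₁ id ⨾ cap       ≈⟨ ⨾-congʳ (⨾-congʳ (bend-span gm')) ⟩
          δ ⨾ f ⊗₁ g ⨾ op B f' ⊗₁ op B g' ⨾ δ* ⨾ ε      ≈⟨ ⨾-assoc _ _ _ ⟨
          ⟨ f , g ⟩ ⨾ op B f' ⊗₁ op B g' ⨾ δ* ⨾ ε       ≈⟨ ⨾-congʳ (⨾-assoc _ _ _) ⟨
          ⟨ f , g ⟩ ⨾ (op B f' ⊗₁ op B g' ⨾ δ*) ⨾ ε     ≈⟨ ⨾-assoc _ _ _ ⟨
          T ⨾ ε                                         ∎
        a = proj₁ (choice T T-total)
        am = proj₁ (proj₂ (choice T T-total))
        a≤T = proj₂ (proj₂ (choice T T-total))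
        -- `T` ends with the right adjoint of `⟨ f' , g' ⟩`, so the counit cancels the two.
        a-pair : a ⨾ ⟨ f' , g' ⟩ ≤ ⟨ f , g ⟩
        a-pair = begin
          a ⨾ ⟨ f' , g' ⟩                                        ≤⟨ ⨾-monoˡ a≤T ⟩
          T ⨾ ⟨ f' , g' ⟩                                        ≈⟨ ⨾-assoc _ _ _ ⟩
          ⟨ f , g ⟩ ⨾ (op B f' ⊗₁ op B g' ⨾ δ*) ⨾ ⟨ f' , g' ⟩    ≤⟨ ⨾-monoʳ (proj₂ (pair-⊣ fm' gm')) ⟩
          ⟨ f , g ⟩ ⨾ id                                         ≈⟨ ⨾-idʳ _ ⟩
          ⟨ f , g ⟩                                              ∎
        extend : ∀ {V} {P : Hom _ V} → a ⨾ ⟨ f' , g' ⟩ ⨾ P ≤ ⟨ f , g ⟩ ⨾ P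
        extend = ≤-trans (proj₂ (⨾-assoc _ _ _)) (⨾-monoˡ a-pair)

    ≈⇒~ : (s t : Span B X Y) → toHom (raw s) ≈ toHom (raw t) → _~_ B (raw s) (raw t)
    ≈⇒~ s t (p , q) = ≤⇒≼ s t p , ≤⇒≼ t s q

    -- Weak pullbacks and the isomorphism with spans

    module _ (enough : EnoughMaps B) where

      open Tabulation

      -- By adjointness and discreteness of maps, `b ⨾ H ≈ c ⨾ K` amounts to
      -- `op B b ⨾ c ≤ H ⨾ op B K`. A span representing the right-hand side is thus weakly
      -- universal, and `≤⇒≼` supplies the mediating map.
      weakPullbacks : HasWeakPullbacks B
      weakPullbacks H K hm km = apex (raw s) , f , g , record
        { f-map = left-map s
        ; g-map = right-map s
        ; commutes = ≈-sym (map-≤⇒≈ (⨾-isMap (right-map s) km) (⨾-isMap (left-map s) hm) commutes≤)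
        ; universal = λ b c bm cm e → ≤⇒≼ (span (rspan _ b c) bm cm) s (universal≤ b c bm e)
        }
        where
          s = tab (tabulate enough (H ⨾ op B K))
          f = left (raw s)
          g = right (raw s)
          fg≈ : op B f ⨾ g ≈ H ⨾ op B K
          fg≈ = toHom-tab (tabulate enough (H ⨾ op B K))
          commutes≤ : g ⨾ K ≤ f ⨾ H
          commutes≤ = begin
            g ⨾ K                 ≤⟨ introˡ≤ (proj₁ (map-⊣-op (left-map s))) ⟩
            f ⨾ op B f ⨾ g ⨾ K    ≈⟨ ⨾-congʳ (extendˡ fg≈) ⟩
            f ⨾ H ⨾ op B K ⨾ K    ≤⟨ ⨾-monoʳ (⨾-monoʳ (proj₂ (map-⊣-op km))) ⟩
            f ⨾ H ⨾ id            ≈⟨ ⨾-congʳ (⨾-idʳ H) ⟩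
            f ⨾ H                 ∎
          universal≤ : ∀ {T} (b : Hom T _) (c : Hom T _) → IsMap B b →
                       b ⨾ H ≈ c ⨾ K → op B b ⨾ c ≤ op B f ⨾ g
          universal≤ b c bm e = begin
            op B b ⨾ c                  ≈⟨ ⨾-congʳ (⨾-idʳ c) ⟨
            op B b ⨾ c ⨾ id             ≤⟨ ⨾-monoʳ (⨾-monoʳ (proj₁ (map-⊣-op km))) ⟩
            op B b ⨾ c ⨾ K ⨾ op B K     ≈⟨ ⨾-congʳ (extendˡ e) ⟨
            op B b ⨾ b ⨾ H ⨾ op B K     ≤⟨ cancelˡ≤ (proj₂ (map-⊣-op bm)) ⟩
            H ⨾ op B K                  ≈⟨ fg≈ ⟨
            op B f ⨾ g                  ∎

      idSpan : Span B X X
      idSpan = span (idS B) id-isMap id-isMap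

      toHom-graph : (F : Hom X Y) → toHom (rspan X id F) ≈ F
      toHom-graph F = elimˡ (op-unique ⊣-id)

      toHom-cograph : {F : Hom X Y} {G : Hom Y X} → F ⊣ G → toHom (rspan X F id) ≈ G
      toHom-cograph a = ≈-trans (⨾-idʳ _) (op-unique a)

      -- `p` repeats the span chosen in `weakPullbacks`, so its legs are definitionally the
      -- projections used by `compS`.
      compSpan : Span B X Y → Span B Y Z → Span B X Z
      compSpan s t = span (compS B weakPullbacks s t)
        (⨾-isMap (left-map p) (left-map s)) (⨾-isMap (right-map p) (right-map t))
        where p = tab (tabulate enough (right (raw s) ⨾ op B (left (raw t))))

      -- The chosen weak pullback satisfies the Beck-Chevalley condition `op B p ⨾ q ≈ g ⨾ op B f'`
      -- by construction.
      toHom-comp : (s : Span B X Y) (t : Span B Y Z) →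
                   toHom (raw (compSpan s t)) ≈ toHom (raw s) ⨾ toHom (raw t)
      toHom-comp (span (rspan _ f g) fm gm) (span (rspan _ f' g') fm' gm') = begin-equality
        op B (p ⨾ f) ⨾ q ⨾ g'              ≈⟨ ⨾-congˡ (op-⨾ (left-map P) fm) ⟩
        (op B f ⨾ op B p) ⨾ q ⨾ g'         ≈⟨ ⨾-assoc _ _ _ ⟩
        op B f ⨾ op B p ⨾ q ⨾ g'           ≈⟨ ⨾-congʳ (extendˡ (toHom-tab (tabulate enough (g ⨾ op B f')))) ⟩
        op B f ⨾ g ⨾ op B f' ⨾ g'          ≈⟨ ⨾-assoc _ _ _ ⟨
        (op B f ⨾ g) ⨾ op B f' ⨾ g'        ∎
        where
          P = tab (tabulate enough (g ⨾ op B f'))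
          p = left (raw P)
          q = right (raw P)

      tensorSpan : Span B X Y → Span B X' Y' → Span B (X ⊗ X') (Y ⊗ Y')
      tensorSpan s t = span (tensorS B (raw s) (raw t))
        (⊗-isMap (left-map s) (left-map t)) (⊗-isMap (right-map s) (right-map t))

      toHom-tensor : (s : Span B X Y) (t : Span B X' Y') →
                     toHom (raw (tensorSpan s t)) ≈ toHom (raw s) ⊗₁ toHom (raw t)
      toHom-tensor s t =
        ≈-trans (⨾-congˡ (op-⊗ (left-map s) (left-map t))) (≈-sym (⊗-⨾ _ _ _ _))

      -- `F` picks a representing span and `G` is `toHom`, both being the identity on objects. As
      -- `toHom` preserves and reflects the order, every law for `F` is checked on images under
      -- `toHom`.
      choice⇒isoToSpan : IsoToSpan B weakPullbacks
      choice⇒isoToSpan = record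
        { F₀ = λ X → X
        ; F₁ = F
        ; F-mono = λ {_} {_} {R} {S} p → ≤⇒≼ (F R) (F S) (begin
            toHom (raw (F R))  ≈⟨ toHom-F R ⟩
            R                  ≤⟨ p ⟩
            S                  ≈⟨ toHom-F S ⟨
            toHom (raw (F S))  ∎)
        ; F-id = F-preserves id idSpan (toHom-graph id)
        ; F-⨾ = λ R S → F-preserves (R ⨾ S) (compSpan (F R) (F S))
            (≈-trans (toHom-comp (F R) (F S)) (⨾-cong (toHom-F R) (toHom-F S)))
        ; F-⊗₀ = refl
        ; F-I₀ = refl
        ; F-⊗₁ = λ R S → F-preserves (R ⊗₁ S) (tensorSpan (F R) (F S))
            (≈-trans (toHom-tensor (F R) (F S)) (⊗-cong (toHom-F R) (toHom-F S)))
        ; F-δ = F-preserves δ δSpan (toHom-graph δ)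
        ; F-ε = F-preserves ε εSpan (toHom-graph ε)
        ; F-δ* = F-preserves δ* δ*Span (toHom-cograph δ⊣δ*)
        ; F-ε* = F-preserves ε* ε*Span (toHom-cograph ε⊣ε*)
        ; G₀ = λ X → X
        ; G₁ = λ s → toHom (raw s)
        ; G-mono = ≼⇒≤
        ; G-id = λ u e → ≈-trans (~⇒≈ u idSpan e) (toHom-graph id)
        ; G-⨾ = λ s t u e → ≈-trans (~⇒≈ u (compSpan s t) e) (toHom-comp s t)
        ; G-⊗₀ = refl
        ; G-I₀ = refl
        ; G-⊗₁ = λ s t u e → ≈-trans (~⇒≈ u (tensorSpan s t) e) (toHom-tensor s t)
        ; G-δ = λ u e → ≈-trans (~⇒≈ u δSpan e) (toHom-graph δ)
        ; G-ε = λ u e → ≈-trans (~⇒≈ u εSpan e) (toHom-graph ε)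
        ; G-δ* = λ u e → ≈-trans (~⇒≈ u δ*Span e) (toHom-cograph δ⊣δ*)
        ; G-ε* = λ u e → ≈-trans (~⇒≈ u ε*Span e) (toHom-cograph ε⊣ε*)
        ; GF₀ = λ _ → refl
        ; FG₀ = λ _ → refl
        ; GF₁ = toHom-F
        ; FG₁ = λ s → ≈⇒~ (F (toHom (raw s))) s (toHom-F _)
        }
        where
          F : Hom X Y → Span B X Y
          F R = tab (tabulate enough R)
          toHom-F : (R : Hom X Y) → toHom (raw (F R)) ≈ R
          toHom-F R = toHom-tab (tabulate enough R)
          F-preserves : (R : Hom X Y) (s : Span B X Y) → toHom (raw s) ≈ R →
                        _~_ B (raw (F R)) (raw s)
          F-preserves R s e = ≈⇒~ (F R) s (≈-trans (toHom-F R) (≈-sym e))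
          δSpan : Span B X (X ⊗ X)
          δSpan = span (δS B) id-isMap δ-isMap
          εSpan : Span B X I
          εSpan = span (εS B) id-isMap ε-isMap
          δ*Span : Span B (X ⊗ X) X
          δ*Span = span (δ*S B) δ-isMap id-isMap
          ε*Span : Span B I X
          ε*Span = span (ε*S B) ε-isMap id-isMap

  -- Span order and transport along object equalities

  ≼-refl : (s : RawSpan B X Y) → _≼_ B s s
  ≼-refl s = id , id-isMap , ⨾-idˡ _ , ⨾-idˡ _

  ~-refl : (s : RawSpan B X Y) → _~_ B s s
  ~-refl s = ≼-refl s , ≼-refl s

  -- Stated for a variable endpoint so that `p` can be matched with `refl`; it is applied to `F-I₀`.
  -- Reindexing the target does not affect the left leg.
  reindexS-section : (p : Y ≡ Y') {s : RawSpan B X Y'} {t : RawSpan B X Y} →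
                     _≼_ B s (reindexS B refl p t) →
                     Σ[ a ∈ Hom (apex s) (apex t) ] (IsMap B a × a ⨾ left t ≈ left s)
  reindexS-section refl (a , am , e , _) = a , am , e

  reindexH-mono : (p : X ≡ X') (q : Y ≡ Y') {R S : Hom X Y} → R ≤ S →
                  reindexH B p q R ≤ reindexH B p q S
  reindexH-mono refl refl R≤S = R≤S

  reindexH-isMap : (p : X ≡ X') (q : Y ≡ Y') {F : Hom X Y} → IsMap B F →
                   IsMap B (reindexH B p q F)
  reindexH-isMap refl refl m = m

  -- Composition of spans for given weak pullbacks

  module SpanComposition (wp : HasWeakPullbacks B) where

    open IsWeakPullback

    module _ (s : Span B X Y) (t : Span B Y Z) where

      comp : RawSpan B X Z
      comp = compS B wp s t

      comp-isMap : IsMap B (left comp) × IsMap B (right comp)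
      comp-isMap with wp (right (raw s)) (left (raw t)) (right-map s) (left-map t)
      ... | _ , _ , _ , w = ⨾-isMap (f-map w) (left-map s) , ⨾-isMap (g-map w) (right-map t)

      composite : Span B X Z
      composite = span comp (proj₁ comp-isMap) (proj₂ comp-isMap)

      -- The square behind a composite, kept apart from its universal property, which enters through
      -- `≼-comp`.
      record Projections (c : RawSpan B X Z) : Set (h ⊔ r) where
        field
          p : Hom (apex c) (apex (raw s))
          q : Hom (apex c) (apex (raw t))
          p-map : IsMap B p
          commuting : p ⨾ right (raw s) ≈ q ⨾ left (raw t)
          left-comp : left c ≈ p ⨾ left (raw s)
          right-comp : right c ≈ q ⨾ right (raw t)

      projections : Projections comp
      projections with wp (right (raw s)) (left (raw t)) (right-map s) (left-map t)
      ... | _ , p , q , w = record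
        { p = p
        ; q = q
        ; p-map = f-map w
        ; commuting = commutes w
        ; left-comp = ≈-refl
        ; right-comp = ≈-refl
        }

      ≼-comp : ∀ {T} (b : Hom T (apex (raw s))) (c : Hom T (apex (raw t))) →
               IsMap B b → IsMap B c → b ⨾ right (raw s) ≈ c ⨾ left (raw t) →
               _≼_ B (rspan T (b ⨾ left (raw s)) (c ⨾ right (raw t))) comp
      ≼-comp b c bm cm e with wp (right (raw s)) (left (raw t)) (right-map s) (left-map t)
      ... | _ , _ , _ , w =
        let a , am , ap , aq = universal w b c bm cm e in a , am , pullˡ ap , pullˡ aq

  -- Choice from an isomorphism with spans

  module _ (wp : HasWeakPullbacks B) (iso : IsoToSpan B wp) where

    open IsoToSpan iso
    open SpanComposition wp
    open Projections

    graph : {F : Hom X Y} → IsMap B F → Span B X Y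
    graph m = span (rspan _ id _) id-isMap m

    cograph : {F : Hom X Y} → IsMap B F → Span B Y X
    cograph m = span (rspan _ _ id) m id-isMap

    module _ {F : Hom X Y} (m : IsMap B F) where

      private
        idX : Span B X X
        idX = span (idS B) id-isMap id-isMap

        idY : Span B Y Y
        idY = span (idS B) id-isMap id-isMap

        kernel : Span B X X
        kernel = composite (graph m) (cograph m)

        image : Span B Y Y
        image = composite (cograph m) (graph m)

        -- The apex of `kernel` is a weak kernel pair of `F`, and the map into it is the diagonal
        -- induced by two identities.
        id≼kernel : _≼_ B (idS B) (raw kernel)
        id≼kernel with ≼-comp (graph m) (cograph m) id id id-isMap id-isMap ≈-refl
        ... | a , am , al , ar = a , am , ≈-trans al (⨾-idˡ _) , ≈-trans ar (⨾-idˡ _)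

        image≼id : _≼_ B (raw image) (idS B)
        image≼id = p P ⨾ F , ⨾-isMap (p-map P) m , toLeft , toRight
          where
            P = projections (cograph m) (graph m)
            toLeft = ≈-trans (⨾-idʳ _) (≈-sym (left-comp P))
            -- The square is over two identity legs, so its projections agree.
            p≈q : p P ≈ q P
            p≈q = ≈-trans (≈-sym (⨾-idʳ _)) (≈-trans (commuting P) (⨾-idʳ _))
            toRight = ≈-trans (⨾-idʳ _) (≈-trans (⨾-congˡ p≈q) (≈-sym (right-comp P)))

      -- Graph and cograph are already adjoint among spans, by `id≼kernel` and `image≼id`; `G`
      -- preserves order, composition and identities, hence adjunctions.
      G-graph⊣G-cograph : G₁ (graph m) ⊣ G₁ (cograph m)
      G-graph⊣G-cograph = unit , counit
        where
          unit : id ≤ G₁ (graph m) ⨾ G₁ (cograph m)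
          unit = begin
            id                              ≈⟨ G-id idX (~-refl (idS B)) ⟨
            G₁ idX                          ≤⟨ G-mono idX kernel id≼kernel ⟩
            G₁ kernel                       ≈⟨ G-⨾ (graph m) (cograph m) kernel (~-refl (raw kernel)) ⟩
            G₁ (graph m) ⨾ G₁ (cograph m)   ∎
          counit : G₁ (cograph m) ⨾ G₁ (graph m) ≤ id
          counit = begin
            G₁ (cograph m) ⨾ G₁ (graph m)   ≈⟨ G-⨾ (cograph m) (graph m) image (~-refl (raw image)) ⟨
            G₁ image                        ≤⟨ G-mono image idY image≼id ⟩
            G₁ idY                          ≈⟨ G-id idY (~-refl (idS B)) ⟩
            id                              ∎

    -- Totality of R says that ε factors through R ⨾ ε, and for spans this splits the left leg of F₁ R.
    left-section : (R : Hom X Y) → IsTotal B R →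
                   Σ[ a ∈ Hom (F₀ X) (apex (raw (F₁ R))) ] (IsMap B a × a ⨾ left (raw (F₁ R)) ≈ id)
    left-section R total
      with b , bm , be ← reindexS-section F-I₀ (proj₂ F-ε)
      with c , cm , ce , _ ← F-mono total
      with d , dm , de , _ ← proj₁ (F-⨾ R ε)
      = b ⨾ c ⨾ d ⨾ p P , ⨾-isMap bm (⨾-isMap cm (⨾-isMap dm (p-map P))) , (begin-equality
          (b ⨾ c ⨾ d ⨾ p P) ⨾ left (raw (F₁ R))
            ≈⟨ ≈-trans (⨾-assoc _ _ _) (⨾-congʳ (≈-trans (⨾-assoc _ _ _) (⨾-congʳ (⨾-assoc _ _ _)))) ⟩
          b ⨾ c ⨾ d ⨾ p P ⨾ left (raw (F₁ R))
            ≈⟨ ⨾-congʳ (⨾-congʳ (⨾-congʳ (left-comp P))) ⟨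
          b ⨾ c ⨾ d ⨾ left (comp (F₁ R) (F₁ ε))
            ≈⟨ ⨾-congʳ (⨾-congʳ de) ⟩
          b ⨾ c ⨾ left (raw (F₁ (R ⨾ ε)))
            ≈⟨ ⨾-congʳ ce ⟩
          b ⨾ left (raw (F₁ ε))
            ≈⟨ be ⟩
          id ∎)
      where P = projections (F₁ R) (F₁ ε)

    isoToSpan⇒choice : AxiomOfChoice B
    isoToSpan⇒choice {X} {Y} R total =
        reindexH B (GF₀ X) (GF₀ Y) (G₁ (graph m))
      , reindexH-isMap (GF₀ X) (GF₀ Y) (leftAdjoint-isMap (G-graph⊣G-cograph m))
      , (begin
          reindexH B (GF₀ X) (GF₀ Y) (G₁ (graph m))
            -- `a` is itself a morphism of spans into `F₁ R`: `section` is its left triangle, and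
            -- its right triangle holds by the choice of `m`.
            ≤⟨ reindexH-mono (GF₀ X) (GF₀ Y) (G-mono (graph m) (F₁ R) (a , am , section , ≈-refl)) ⟩
          reindexH B (GF₀ X) (GF₀ Y) (G₁ (F₁ R))
            ≈⟨ GF₁ R ⟩
          R ∎)
      where
        a : Hom (F₀ X) (apex (raw (F₁ R)))
        a = proj₁ (left-section R total)
        am : IsMap B a
        am = proj₁ (proj₂ (left-section R total))
        section : a ⨾ left (raw (F₁ R)) ≈ id
        section = proj₂ (proj₂ (left-section R total))
        m : IsMap B (a ⨾ right (raw (F₁ R)))
        m = ⨾-isMap am (right-map (F₁ R))

theorem4p11 : ∀ {o h r} (B : CartBicat o h r) → EnoughMaps B →
    (AxiomOfChoice B ⇔ Σ (HasWeakPullbacks B) (IsoToSpan B))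
theorem4p11 B enough = mk⇔ forward backward
  where
    open CartBicatProperties B
    forward : AxiomOfChoice B → Σ (HasWeakPullbacks B) (IsoToSpan B)
    forward choice = weakPullbacks choice enough , choice⇒isoToSpan choice enough
    backward : Σ (HasWeakPullbacks B) (IsoToSpan B) → AxiomOfChoice B
    backward (wp , iso) = isoToSpan⇒choice wp iso
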